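{- Let $K=\mathbb{F}_q$ be a finite field. Let $\mathcal{G}$ be a bipartite simple graph with a perfect matching, labelled as in the context, with $2k$ vertices and $s$ edges; let $\mathbb{X}\subseteq\mathbb{P}^{s-1}$ be the toric set parameterized by its edges, $C_{\mathbb{X}}(d)$ the associated code of order $d$, and $\mathbb{Y}\subseteq\mathbb{X}$ the set defined in the context. For $d\ge0$ let $H_{\psi}(d)=\dim_K(I_{\mathbb{Y}}(d)/I_{\mathbb{X}}(d))$. Then for all integers $d\ge0$, $$\dim_K C_{\mathbb{X}}(d)=H_{\mathbb{X}}(d)=H_{\psi}(d)+H_{\mathbb{T}_{k-1}}(d).$$
   Context: Setting: $\mathcal{G}$ is a bipartite simple graph on vertices $v_1,\ldots,v_{2k}$ with $s$ edges, every edge joining a vertex of $\{v_1,v_3,\ldots,v_{2k-1}\}$ to a vertex of $\{v_2,v_4,\ldots,v_{2k}\}$, and $\{\{v_{2i-1},v_{2i}\}: i=1,\ldots,k\}$ is a perfect matching of $\mathcal{G}$. Let $n_i=\deg v_i$, so $n_1+n_3+\cdots+n_{2k-1}=s$. The edges are ordered in consecutive blocks: first the $n_1$ edges incident with $v_1$ (starting with $\{v_1,v_2\}$), then the $n_3$ edges incident with $v_3$ (starting with $\{v_3,v_4\}$), and so on, finally the $n_{2k-1}$ edges incident with $v_{2k-1}$ (starting with $\{v_{2k-1},v_{2k}\}$). With $K^*=K\setminus\{0\}$, the toric set parameterized by the edges is the set $\mathbb{X}\subseteq\mathbb{P}^{s-1}$ of all points, for $(t_1,\ldots,t_{2k})\in(K^*)^{2k}$,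 whose coordinate at the edge $\{v_j,v_l\}$ is $t_jt_l$ (coordinates ordered as the edges are: first the $n_1$ edges incident with $v_1$, then the $n_3$ edges incident with $v_3$, and so on, finally the $n_{2k-1}$ edges incident with $v_{2k-1}$, the block of $v_{2i-1}$ starting with the edge $\{v_{2i-1},v_{2i}\}$). Further $$\mathbb{Y}=\{[t_1,\ldots,t_1,t_3,\ldots,t_3,\ldots,t_{2k-1},\ldots,t_{2k-1}]\in\mathbb{P}^{s-1}: t_i\in K^*\},$$ where $t_i$ appears $n_i$ times for $i=1,3,\ldots,2k-1$. The projective torus is $\mathbb{T}_{k-1}=\{[t_1,\ldots,t_k]\in\mathbb{P}^{k-1}: t_i\in K^*\}$. For a set of points $\mathbb{Z}\subseteq\mathbb{P}^{r-1}$ and $A=K[X_1,\ldots,X_r]=\oplus_{d\ge0}A_d$ with the standard grading, $I_{\mathbb{Z}}\subseteq A$ is the ideal generated by the homogeneous polynomials vanishing at all points of $\mathbb{Z}$, $I_{\mathbb{Z}}(d)=I_{\mathbb{Z}}\cap A_d$, and $H_{\mathbb{Z}}(d)=\dim_K(A_d/I_{\mathbb{Z}}(d))$. Since $\mathbb{Y}\subseteq\mathbb{X}$, $I_{\mathbb{X}}\subseteq I_{\mathbb{Y}}$. If $\mathbb{X}=\{P_1,\ldots,P_{|\mathbb{X}|}\}$ and $S=K[X_1,\ldots,X_s]$, the code of order $d$ is $$C_{\mathbb{X}}(d)=\left\{\left(\frac{f(P_1)}{X_1^d(P_1)},\ldots,\frac{f(P_{|\mathbb{X}|})}{X_1^d(P_{|\mathbb{X}|})}\right):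 f\in S_d\right\}\subseteq K^{|\mathbb{X}|}.$$ -}

module Defs where

open import Algebra.Apartness.Bundles using (HeytingField)
open import Algebra.Bundles using (Semiring; Ring; AbelianGroup)
import Algebra.Construct.Pointwise as Pointwise
import Algebra.Definitions.RawMonoid as Sum
import Algebra.Definitions.RawSemiring as RawSemiringOps
open import Algebra.Module.Bundles using (LeftModule)
open import Algebra.Module.Bundles.Raw using (RawLeftModule)
open import Algebra.Module.Morphism.Structures using (IsLeftModuleMonomorphism)
import Algebra.Module.Morphism.LeftModuleMonomorphism as Mono
import Algebra.Module.Properties.LeftModule as LeftModuleProperties
import Algebra.Properties.AbelianGroup as AbelianGroupProperties
import Algebra.Properties.CommutativeSemigroup as CommutativeSemigroupProperties
import Algebra.Properties.Ring as RingProperties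
import Algebra.Apartness.Properties.HeytingCommutativeRing as HCRProperties
open import Data.Fin.Base as Fin using (Fin; zero; suc; combine)
open import Data.List.Base using (List; []; _∷_; _++_; foldr; map; cartesianProductWith)
open import Data.Nat.Base as ℕ using (ℕ; zero; suc; NonZero)
import Data.Nat.Properties as ℕ
open import Data.Product.Base using (∃; ∃-syntax; ∃₂; _×_; _,_; proj₁; proj₂)
open import Data.Sum.Base using (_⊎_)
open import Data.Vec.Base as Vec using (Vec; lookup; zipWith)
import Data.Vec.Properties as Vec
open import Data.Vec.Functional using (Vector)
open import Function.Base using (id; _∘_)
open import Function.Bundles using (Inverse)
open import Level using (_⊔_; 0ℓ) renaming (suc to lsuc)
open import Relation.Binary.Core using (Rel)
open import Relation.Binary.Definitions using (Symmetric)
open import Relation.Binary.PropositionalEquality as ≡ using (_≡_; _≢_)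
import Relation.Binary.Reasoning.Setoid as ≈-Reasoning
open import Relation.Nullary.Decidable.Core using (yes; no)
open import Relation.Nullary.Negation.Core using (¬_)
open import Relation.Unary using (Pred; _∈_)

module LinearAlgebra {r ℓr} (R : Ring r ℓr) where

  open Ring R using (Carrier; _≈_; 0#; 1#; -_)

  module _ {m ℓm} (M : LeftModule R m ℓm) where
    open LeftModule M

    combination : ∀ {n} → Vector Carrier n → Vector Carrierᴹ n → Carrierᴹ
    combination a v = Sum.sum (AbelianGroup.rawMonoid +ᴹ-abelianGroup) (λ i → a i *ₗ v i)

    LinearlyIndependent : ∀ {n} → Vector Carrierᴹ n → Set (r ⊔ ℓr ⊔ ℓm)
    LinearlyIndependent v = ∀ a → combination a v ≈ᴹ 0ᴹ → ∀ i → a i ≈ 0#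

    Spanning : ∀ {n} → Vector Carrierᴹ n → Set (r ⊔ m ⊔ ℓm)
    Spanning v = ∀ x → ∃[ a ] combination a v ≈ᴹ x

    -- For R a field: the dimension of M is n.
    HasDimension : ℕ → Set (r ⊔ ℓr ⊔ m ⊔ ℓm)
    HasDimension n = ∃[ v ] LinearlyIndependent {n} v × Spanning v

    record Submodule p : Set (r ⊔ m ⊔ ℓm ⊔ lsuc p) where
      field
        Member    : Pred Carrierᴹ p
        resp      : ∀ {x y} → x ≈ᴹ y → Member x → Member y
        0-closed  : Member 0ᴹ
        +-closed  : ∀ {x y} → Member x → Member y → Member (x +ᴹ y)
        *ₗ-closed : ∀ a {x} → Member x → Member (a *ₗ x)

  module _ {m ℓm} {M : LeftModule R m ℓm} where
    open LeftModule M
    private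
      module P = LeftModuleProperties M
      module A = AbelianGroupProperties +ᴹ-abelianGroup
      module C = CommutativeSemigroupProperties
                   (AbelianGroup.commutativeSemigroup +ᴹ-abelianGroup)
      module ≈ᴹ = ≈-Reasoning ≈ᴹ-setoid

    -1*x≈-x : ∀ x → (- 1#) *ₗ x ≈ᴹ -ᴹ x
    -1*x≈-x x = P.inverseˡ-uniqueᴹ _ _ (begin
      (- 1#) *ₗ x +ᴹ x            ≈⟨ +ᴹ-cong ≈ᴹ-refl (*ₗ-identityˡ x) ⟨
      (- 1#) *ₗ x +ᴹ 1# *ₗ x      ≈⟨ *ₗ-distribʳ x (- 1#) 1# ⟨
      (Ring._+_ R (- 1#) 1#) *ₗ x ≈⟨ *ₗ-cong (Ring.-‿inverseˡ R 1#) ≈ᴹ-refl ⟩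
      0# *ₗ x                     ≈⟨ *ₗ-zeroˡ x ⟩
      0ᴹ                          ∎)
      where open ≈ᴹ

    module _ {p} (N : Submodule M p) where
      open Submodule N

      -‿closed : ∀ {x} → Member x → Member (-ᴹ x)
      -‿closed x∈N = resp (-1*x≈-x _) (*ₗ-closed (- 1#) x∈N)

      submodule : LeftModule R (m ⊔ p) ℓm
      submodule = record
        { isLeftModule = Mono.isLeftModule {N = rawLeftModule} isMono (Ring.isRing R) isLeftModule }
        where
        raw : RawLeftModule Carrier (m ⊔ p) ℓm
        raw = record
          { Carrierᴹ = ∃ Member
          ; _≈ᴹ_     = λ x y → proj₁ x ≈ᴹ proj₁ y
          ; _+ᴹ_     = λ (x , x∈N) (y , y∈N) → x +ᴹ y , +-closed x∈N y∈N
          ; _*ₗ_     = λ a (x , x∈N) → a *ₗ x , *ₗ-closed a x∈N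
          ; 0ᴹ       = 0ᴹ , 0-closed
          ; -ᴹ_      = λ (x , x∈N) → -ᴹ x , -‿closed x∈N
          }
        isMono : IsLeftModuleMonomorphism raw rawLeftModule proj₁
        isMono = record
          { isLeftModuleHomomorphism = record
            { +ᴹ-isGroupHomomorphism = record
              { isMonoidHomomorphism = record
                { isMagmaHomomorphism = record
                  { isRelHomomorphism = record { cong = id }
                  ; homo = λ _ _ → ≈ᴹ-refl
                  }
                ; ε-homo = ≈ᴹ-refl
                }
              ; ⁻¹-homo = λ _ → ≈ᴹ-refl
              }
            ; *ₗ-homo = λ _ _ → ≈ᴹ-refl
            }
          ; injective = id
          }

      quotient : LeftModule R m p
      quotient = record
        { _≈ᴹ_ = _≈/_
        ; _+ᴹ_ = _+ᴹ_
        ; _*ₗ_ = _*ₗ_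
        ; 0ᴹ   = 0ᴹ
        ; -ᴹ_  = -ᴹ_
        ; isLeftModule = record
          { isLeftSemimodule = record
            { +ᴹ-isCommutativeMonoid = record
              { isMonoid = record
                { isSemigroup = record
                  { isMagma = record
                    { isEquivalence = record
                      { refl  = ≈⇒≈/ ≈ᴹ-refl
                      ; sym   = λ {x} {y} → resp (A.⁻¹-anti-homo‿- x y) ∘ -‿closed
                      ; trans = λ x/y y/z → resp telescope (+-closed x/y y/z)
                      }
                    ; ∙-cong = λ x/y u/v → resp interchange (+-closed x/y u/v)
                    }
                  ; assoc = λ x y z → ≈⇒≈/ (+ᴹ-assoc x y z)
                  }
                ; identity = ≈⇒≈/ ∘ +ᴹ-identityˡ , ≈⇒≈/ ∘ +ᴹ-identityʳ
                }
              ; comm = λ x y → ≈⇒≈/ (+ᴹ-comm x y)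
              }
            ; isPreleftSemimodule = record
              { *ₗ-cong      = λ {a} a≈b x/y → resp (scale a≈b) (*ₗ-closed a x/y)
              ; *ₗ-zeroˡ     = λ x → ≈⇒≈/ (*ₗ-zeroˡ x)
              ; *ₗ-distribʳ  = λ x a b → ≈⇒≈/ (*ₗ-distribʳ x a b)
              ; *ₗ-identityˡ = λ x → ≈⇒≈/ (*ₗ-identityˡ x)
              ; *ₗ-assoc     = λ a b x → ≈⇒≈/ (*ₗ-assoc a b x)
              ; *ₗ-zeroʳ     = λ a → ≈⇒≈/ (*ₗ-zeroʳ a)
              ; *ₗ-distribˡ  = λ a x y → ≈⇒≈/ (*ₗ-distribˡ a x y)
              }
            }
          ; -ᴹ‿cong    = λ {x} {y} x/y → resp (≈ᴹ-sym (A.⁻¹-∙-comm x (-ᴹ y))) (-‿closed x/y)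
          ; -ᴹ‿inverse = ≈⇒≈/ ∘ -ᴹ‿inverseˡ , ≈⇒≈/ ∘ -ᴹ‿inverseʳ
          }
        }
        where
        open ≈ᴹ
        infix 4 _≈/_
        _≈/_ : Rel Carrierᴹ p
        x ≈/ y = Member (x +ᴹ -ᴹ y)

        ≈⇒≈/ : ∀ {x y} → x ≈ᴹ y → x ≈/ y
        ≈⇒≈/ {x} {y} x≈y = resp
          (≈ᴹ-sym (≈ᴹ-trans (+ᴹ-cong x≈y ≈ᴹ-refl) (-ᴹ‿inverseʳ y))) 0-closed

        telescope : ∀ {x y z} → (x +ᴹ -ᴹ y) +ᴹ (y +ᴹ -ᴹ z) ≈ᴹ x +ᴹ -ᴹ z
        telescope {x} {y} {z} = begin
          (x +ᴹ -ᴹ y) +ᴹ (y +ᴹ -ᴹ z) ≈⟨ +ᴹ-assoc x (-ᴹ y) _ ⟩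
          x +ᴹ (-ᴹ y +ᴹ (y +ᴹ -ᴹ z)) ≈⟨ +ᴹ-cong ≈ᴹ-refl (+ᴹ-assoc (-ᴹ y) y _) ⟨
          x +ᴹ ((-ᴹ y +ᴹ y) +ᴹ -ᴹ z) ≈⟨ +ᴹ-cong ≈ᴹ-refl (+ᴹ-cong (-ᴹ‿inverseˡ y) ≈ᴹ-refl) ⟩
          x +ᴹ (0ᴹ +ᴹ -ᴹ z)          ≈⟨ +ᴹ-cong ≈ᴹ-refl (+ᴹ-identityˡ _) ⟩
          x +ᴹ -ᴹ z                  ∎

        interchange : ∀ {x y u v} → (x +ᴹ -ᴹ y) +ᴹ (u +ᴹ -ᴹ v) ≈ᴹ (x +ᴹ u) +ᴹ -ᴹ (y +ᴹ v)
        interchange {x} {y} {u} {v} = begin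
          (x +ᴹ -ᴹ y) +ᴹ (u +ᴹ -ᴹ v) ≈⟨ C.interchange x (-ᴹ y) u (-ᴹ v) ⟩
          (x +ᴹ u) +ᴹ (-ᴹ y +ᴹ -ᴹ v) ≈⟨ +ᴹ-cong ≈ᴹ-refl (A.⁻¹-∙-comm y v) ⟩
          (x +ᴹ u) +ᴹ -ᴹ (y +ᴹ v)    ∎

        *ₗ-neg : ∀ a x → a *ₗ (-ᴹ x) ≈ᴹ -ᴹ (a *ₗ x)
        *ₗ-neg a x = P.inverseˡ-uniqueᴹ _ _ (begin
          a *ₗ (-ᴹ x) +ᴹ a *ₗ x ≈⟨ *ₗ-distribˡ a (-ᴹ x) x ⟨
          a *ₗ (-ᴹ x +ᴹ x)      ≈⟨ *ₗ-cong (Ring.refl R) (-ᴹ‿inverseˡ x) ⟩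
          a *ₗ 0ᴹ               ≈⟨ *ₗ-zeroʳ a ⟩
          0ᴹ                    ∎)

        scale : ∀ {a b x y} → a ≈ b → a *ₗ (x +ᴹ -ᴹ y) ≈ᴹ a *ₗ x +ᴹ -ᴹ (b *ₗ y)
        scale {a} {b} {x} {y} a≈b = begin
          a *ₗ (x +ᴹ -ᴹ y)      ≈⟨ *ₗ-distribˡ a x (-ᴹ y) ⟩
          a *ₗ x +ᴹ a *ₗ (-ᴹ y) ≈⟨ +ᴹ-cong ≈ᴹ-refl (*ₗ-neg a y) ⟩
          a *ₗ x +ᴹ -ᴹ (a *ₗ y) ≈⟨ +ᴹ-cong ≈ᴹ-refl (-ᴹ‿cong (*ₗ-cong a≈b ≈ᴹ-refl)) ⟩
          a *ₗ x +ᴹ -ᴹ (b *ₗ y) ∎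

  module _ {m ℓm} {M : LeftModule R m ℓm} where

    infixr 7 _∩_
    infixl 6 _/_

    _∩_ : ∀ {p p′} → Submodule M p → Submodule M p′ → Submodule M (p ⊔ p′)
    V ∩ W = record
      { Member    = λ x → V.Member x × W.Member x
      ; resp      = λ x≈y (v , w) → V.resp x≈y v , W.resp x≈y w
      ; 0-closed  = V.0-closed , W.0-closed
      ; +-closed  = λ (v , w) (v′ , w′) → V.+-closed v v′ , W.+-closed w w′
      ; *ₗ-closed = λ a (v , w) → V.*ₗ-closed a v , W.*ₗ-closed a w
      }
      where
      module V = Submodule V
      module W = Submodule W

    -- V / W is literally V / (V ∩ W); it is used with W ⊆ V.
    _/_ : ∀ {p p′} → Submodule M p → Submodule M p′ → LeftModule R (m ⊔ p) p′
    V / W = quotient {M = submodule V} (record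
      { Member    = W.Member ∘ proj₁
      ; resp      = λ x≈y x∈W → W.resp x≈y x∈W
      ; 0-closed  = W.0-closed
      ; +-closed  = λ x∈W y∈W → W.+-closed x∈W y∈W
      ; *ₗ-closed = λ a x∈W → W.*ₗ-closed a x∈W
      })
      where module W = Submodule W

  functions : ∀ {i} → Set i → LeftModule R (i ⊔ r) (i ⊔ ℓr)
  functions I = record
    { _*ₗ_ = λ a f i → a * f i
    ; isLeftModule = record
      { isLeftSemimodule = record
        { +ᴹ-isCommutativeMonoid = AbelianGroup.isCommutativeMonoid pw
        ; isPreleftSemimodule = record
          { *ₗ-cong      = λ a≈b f≈g i → *-cong a≈b (f≈g i)
          ; *ₗ-zeroˡ     = λ f i → zeroˡ (f i)
          ; *ₗ-distribʳ  = λ f a b i → distribʳ (f i) a b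
          ; *ₗ-identityˡ = λ f i → *-identityˡ (f i)
          ; *ₗ-assoc     = λ a b f i → *-assoc a b (f i)
          ; *ₗ-zeroʳ     = λ a i → zeroʳ a
          ; *ₗ-distribˡ  = λ a f g i → distribˡ a (f i) (g i)
          }
        }
      ; -ᴹ‿cong    = AbelianGroup.⁻¹-cong pw
      ; -ᴹ‿inverse = AbelianGroup.inverse pw
      }
    }
    where
    open Ring R
    pw : AbelianGroup _ _
    pw = Pointwise.abelianGroup I +-abelianGroup

HasOrder : ∀ {c ℓ₁ ℓ₂} → HeytingField c ℓ₁ ℓ₂ → ℕ → Set (c ⊔ ℓ₁)
HasOrder K q = Inverse (HeytingField.setoid K) (≡.setoid (Fin q))

module OverField {c ℓ₁ ℓ₂} (K : HeytingField c ℓ₁ ℓ₂) where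

  open HeytingField K hiding (zero)
  open HCRProperties heytingCommutativeRing using (x#0y#0→xy#0; 1#0)

  ring : Ring c ℓ₁
  ring = record { isRing = isRing }

  open LinearAlgebra ring public
  open RawSemiringOps (Semiring.rawSemiring (Ring.semiring ring)) using (product; _^_)

  private
    module R = RingProperties ring

  -- The inverse provided by #⇒invertible is that of y - 0#.
  divide : ∀ x {y} → y # 0# → Carrier
  divide x y#0 = x * proj₁ (#⇒invertible y#0)

  ^#0 : ∀ {x} → x # 0# → ∀ n → x ^ n # 0#
  ^#0 x#0 zero    = 1#0
  ^#0 x#0 (suc n) = x#0y#0→xy#0 x#0 (^#0 x#0 n)

  -- K[X₁,…,X_r].  A polynomial is a finite formal sum of terms a·X^e,
  -- possibly with repetitions; equality is equality of all coefficients.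

  Exponent : ℕ → Set
  Exponent r = Vec ℕ r

  Poly : ℕ → Set c
  Poly r = List (Carrier × Exponent r)

  module _ {r : ℕ} where

    addCoeff : Exponent r → Carrier × Exponent r → Carrier → Carrier
    addCoeff e (a , e′) b with Vec.≡-dec ℕ._≟_ e e′
    ... | yes _ = a + b
    ... | no  _ = b

    coeff : Poly r → Exponent r → Carrier
    coeff p e = foldr (addCoeff e) 0# p

    infixl 7 _*ᴾ_
    _*ᴾ_ : Poly r → Poly r → Poly r
    _*ᴾ_ = cartesianProductWith λ (a , e) (b , e′) → a * b , zipWith ℕ._+_ e e′

    scaleᴾ : Carrier → Poly r → Poly r
    scaleᴾ a = map λ (b , e) → a * b , e

    negᴾ : Poly r → Poly r
    negᴾ = map λ (b , e) → - b , e

    constant : Carrier → Poly r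
    constant a = (a , Vec.replicate r 0) ∷ []

    eval : Poly r → Vector Carrier r → Carrier
    eval p x = foldr (λ (a , e) b → a * product (λ i → x i ^ lookup e i) + b) 0# p

    coeff-++ : ∀ p q e → coeff (p ++ q) e ≈ coeff p e + coeff q e
    coeff-++ []             q e = sym (+-identityˡ _)
    coeff-++ ((a , e′) ∷ p) q e with Vec.≡-dec ℕ._≟_ e e′
    ... | yes _ = trans (+-congˡ (coeff-++ p q e)) (sym (+-assoc a _ _))
    ... | no  _ = coeff-++ p q e

    coeff-scale : ∀ a p e → coeff (scaleᴾ a p) e ≈ a * coeff p e
    coeff-scale a []             e = sym (zeroʳ a)
    coeff-scale a ((b , e′) ∷ p) e with Vec.≡-dec ℕ._≟_ e e′
    ... | yes _ = trans (+-congˡ (coeff-scale a p e)) (sym (distribˡ a b _))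
    ... | no  _ = coeff-scale a p e

    coeff-neg : ∀ p e → coeff (negᴾ p) e ≈ - coeff p e
    coeff-neg []             e = sym R.-0#≈0#
    coeff-neg ((b , e′) ∷ p) e with Vec.≡-dec ℕ._≟_ e e′
    ... | yes _ = trans (+-congˡ (coeff-neg p e)) (R.-‿+-comm b _)
    ... | no  _ = coeff-neg p e

    constant-* : ∀ a p → constant a *ᴾ p ≡ scaleᴾ a p
    constant-* a [] = ≡.refl
    constant-* a ((b , e) ∷ p) =
      ≡.cong₂ (λ e′ q → (a * b , e′) ∷ q) (Vec.zipWith-identityˡ ℕ.+-identityˡ e) (constant-* a p)

    eval-++ : ∀ p q x → eval (p ++ q) x ≈ eval p x + eval q x
    eval-++ []      q x = sym (+-identityˡ _)
    eval-++ (_ ∷ p) q x = trans (+-congˡ (eval-++ p q x)) (sym (+-assoc _ _ _))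

    eval-scale : ∀ a p x → eval (scaleᴾ a p) x ≈ a * eval p x
    eval-scale a []            x = sym (zeroʳ a)
    eval-scale a ((b , e) ∷ p) x =
      trans (+-cong (*-assoc a b _) (eval-scale a p x)) (sym (distribˡ a _ _))

  polynomials : ℕ → LeftModule ring c ℓ₁
  polynomials r = record
    { isLeftModule = Mono.isLeftModule
        {N = LeftModule.rawLeftModule (functions (Exponent r))}
        isMono isRing (LeftModule.isLeftModule (functions (Exponent r)))
    }
    where
    raw : RawLeftModule Carrier c ℓ₁
    raw = record
      { Carrierᴹ = Poly r
      ; _≈ᴹ_     = λ p q → ∀ e → coeff p e ≈ coeff q e
      ; _+ᴹ_     = _++_
      ; _*ₗ_     = scaleᴾ
      ; 0ᴹ       = []
      ; -ᴹ_      = negᴾ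
      }
    isMono : IsLeftModuleMonomorphism raw (LeftModule.rawLeftModule (functions (Exponent r))) coeff
    isMono = record
      { isLeftModuleHomomorphism = record
        { +ᴹ-isGroupHomomorphism = record
          { isMonoidHomomorphism = record
            { isMagmaHomomorphism = record
              { isRelHomomorphism = record { cong = id }
              ; homo = coeff-++
              }
            ; ε-homo = λ _ → refl
            }
          ; ⁻¹-homo = coeff-neg
          }
        ; *ₗ-homo = coeff-scale
        }
      ; injective = id
      }

  -- The graded piece A_d of A = K[X₁,…,X_r].
  homogeneous : ∀ r → ℕ → Submodule (polynomials r) ℓ₁
  homogeneous r d = record
    { Member    = λ p → ∀ e → Vec.sum e ≢ d → coeff p e ≈ 0#
    ; resp      = λ p≈q hp e ne → trans (sym (p≈q e)) (hp e ne)
    ; 0-closed  = λ _ _ → refl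
    ; +-closed  = λ {p} {q} hp hq e ne →
        trans (coeff-++ p q e) (trans (+-cong (hp e ne) (hq e ne)) (+-identityˡ 0#))
    ; *ₗ-closed = λ a {p} hp e ne →
        trans (coeff-scale a p e) (trans (*-congˡ (hp e ne)) (zeroʳ a))
    }

  data Generated {r p} (S : Pred (Poly r) p) : Pred (Poly r) (c ⊔ ℓ₁ ⊔ p) where
    gen    : ∀ {f} → f ∈ S → f ∈ Generated S
    0∈     : [] ∈ Generated S
    +∈     : ∀ {f g} → f ∈ Generated S → g ∈ Generated S → f ++ g ∈ Generated S
    *∈     : ∀ g {f} → f ∈ Generated S → g *ᴾ f ∈ Generated S
    resp-≈ : ∀ {f g} → LeftModule._≈ᴹ_ (polynomials r) f g →
             f ∈ Generated S → g ∈ Generated S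

  ideal : ∀ {r p} → Pred (Poly r) p → Submodule (polynomials r) (c ⊔ ℓ₁ ⊔ p)
  ideal S = record
    { Member    = Generated S
    ; resp      = resp-≈
    ; 0-closed  = 0∈
    ; +-closed  = +∈
    ; *ₗ-closed = λ a {f} f∈I → ≡.subst (Generated S) (constant-* a f) (*∈ (constant a) f∈I)
    }

  -- Points of ℙ^{r-1}, up to _∼_ on coordinates.
  record Point (r : ℕ) : Set (c ⊔ ℓ₂) where
    field
      coords  : Vector Carrier r
      nonzero : ∃[ i ] coords i # 0#
  open Point public

  infix 4 _∼_
  _∼_ : ∀ {r} → Rel (Vector Carrier r) (c ⊔ ℓ₁ ⊔ ℓ₂)
  x ∼ y = ∃[ a ] a # 0# × (∀ i → x i ≈ a * y i)

  -- {[φ(t)] : t ∈ (K*)ⁿ}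
  torusImage : ∀ {n r} → (Vector Carrier n → Vector Carrier r) → Pred (Point r) (c ⊔ ℓ₁ ⊔ ℓ₂)
  torusImage φ P = ∃[ t ] (∀ i → t i # 0#) × coords P ∼ φ t

  𝕋 : ∀ r → Pred (Point r) (c ⊔ ℓ₁ ⊔ ℓ₂)
  𝕋 r = torusImage {r} id

  VanishingOn : ∀ {r p} → Pred (Point r) p → Pred (Poly r) (c ⊔ ℓ₁ ⊔ ℓ₂ ⊔ p)
  VanishingOn Z f =
    (∃[ d ] Submodule.Member (homogeneous _ d) f) × (∀ P → P ∈ Z → eval f (coords P) ≈ 0#)

  vanishingIdeal : ∀ {r p} → Pred (Point r) p → Submodule (polynomials r) (c ⊔ ℓ₁ ⊔ ℓ₂ ⊔ p)
  vanishingIdeal Z = ideal (VanishingOn Z)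

  -- I_Z(d)
  vanishingIdealPart : ∀ {r p} → Pred (Point r) p → ℕ →
                       Submodule (polynomials r) (c ⊔ ℓ₁ ⊔ ℓ₂ ⊔ p)
  vanishingIdealPart Z d = vanishingIdeal Z ∩ homogeneous _ d

  -- H_Z(d) = h
  HilbertFunction : ∀ {r p} → Pred (Point r) p → ℕ → ℕ → Set (c ⊔ ℓ₁ ⊔ ℓ₂ ⊔ p)
  HilbertFunction {r} Z d h = HasDimension (homogeneous r d / vanishingIdealPart Z d) h

  -- Z = {P₁,…,P_m} with the P_i pairwise distinct.
  record Enumeration {r p} (Z : Pred (Point r) p) (m : ℕ) : Set (c ⊔ ℓ₁ ⊔ ℓ₂ ⊔ p) where
    field
      point    : Fin m → Point r
      sound    : ∀ i → point i ∈ Z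
      distinct : ∀ {i j} → coords (point i) ∼ coords (point j) → i ≡ j
      complete : ∀ P → P ∈ Z → ∃[ i ] coords P ∼ coords (point i)

  first : ∀ r → .{{NonZero r}} → Fin r
  first (suc r) = zero

  code : ∀ {r p} .{{_ : NonZero r}} (Z : Pred (Point r) p) →
         (∀ P → P ∈ Z → coords P (first r) # 0#) →
         ∀ {m} → Enumeration Z m → ℕ →
         Submodule (functions (Fin m)) (c ⊔ ℓ₁)
  code {r} Z X₁#0 {m} E d = record
    { Member    = λ w → ∃[ f ] f ∈ S_d × (∀ i → w i ≈ entry f i)
    ; resp      = λ w≈v (f , hf , w≈) → f , hf , λ i → trans (sym (w≈v i)) (w≈ i)
    ; 0-closed  = [] , (λ _ _ → refl) , λ i → sym (zeroˡ _)
    ; +-closed  = λ (f , hf , w≈) (g , hg , v≈) →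
        f ++ g , Submodule.+-closed (homogeneous r d) {f} {g} hf hg , λ i →
        trans (+-cong (w≈ i) (v≈ i)) (trans (sym (distribʳ _ _ _))
          (*-congʳ (sym (eval-++ f g _))))
    ; *ₗ-closed = λ a (f , hf , w≈) →
        scaleᴾ a f , Submodule.*ₗ-closed (homogeneous r d) a {f} hf , λ i →
        trans (*-congˡ (w≈ i)) (trans (sym (*-assoc a _ _))
          (*-congʳ (sym (eval-scale a f _))))
    }
    where
    open Enumeration E
    S_d : Pred (Poly r) ℓ₁
    S_d = Submodule.Member (homogeneous r d)
    -- f(P_i) / X₁^d(P_i)
    entry : Poly r → Fin m → Carrier
    entry f i = divide (eval f (coords (point i)))
                       (^#0 (X₁#0 (point i) (sound i)) d)

record SimpleGraph (n : ℕ) : Set₁ where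
  field
    Adjacent : Rel (Fin n) 0ℓ
    symm     : Symmetric Adjacent
    loopless : ∀ {v} → ¬ Adjacent v v

-- Numbering the vertices from 0, odd i and even i (i = 0,…,k-1) are the
-- vertices v_{2i+1} and v_{2i+2} of {v_1,…,v_{2k}}.
odd even : ∀ {k} → Fin k → Fin (k ℕ.* 2)
odd  i = combine i zero
even i = combine i (suc zero)

-- The pairs {odd i, even i} always partition the vertices, so they form a
-- perfect matching as soon as they are edges.
record IsMatchedBipartite k (G : SimpleGraph (k ℕ.* 2)) : Set where
  open SimpleGraph G
  field
    bipartite : ∀ {u w} → Adjacent u w →
                ∃₂ λ (i j : Fin k) → (u ≡ odd i × w ≡ even j) ⊎ (u ≡ even j × w ≡ odd i)
    matching  : ∀ (i : Fin k) → Adjacent (odd i) (even i)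

-- A numbering of the s edges of G by blocks: the edge at position e is
-- {odd (block e), even (partner e)}.  The block of odd i consists of the
-- deg(odd i) consecutive positions e with block e ≡ i.
record EdgeOrdering k (G : SimpleGraph (k ℕ.* 2)) (s : ℕ) : Set where
  open SimpleGraph G
  field
    block partner : Fin s → Fin k
    isEdge        : ∀ e → Adjacent (odd (block e)) (even (partner e))
    injective     : ∀ {e e′} → block e ≡ block e′ → partner e ≡ partner e′ → e ≡ e′
    surjective    : ∀ {i j : Fin k} → Adjacent (odd i) (even j) → ∃[ e ] block e ≡ i × partner e ≡ j
    consecutive   : ∀ {e e′} → e Fin.≤ e′ → block e Fin.≤ block e′
    matchedFirst  : ∀ {e e′} → block e ≡ block e′ → partner e ≡ block e → e Fin.≤ e′

module ToricSets {c ℓ₁ ℓ₂} (K : HeytingField c ℓ₁ ℓ₂)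
                 {k s : ℕ} {G : SimpleGraph (k ℕ.* 2)} (O : EdgeOrdering k G s) where

  open HeytingField K
  open HCRProperties heytingCommutativeRing using (x#0y#0→xy#0; #-congʳ)
  open OverField K
  open EdgeOrdering O

  edgeMonomials : Vector Carrier (k ℕ.* 2) → Vector Carrier s
  edgeMonomials t e = t (odd (block e)) * t (even (partner e))

  𝕏 : Pred (Point s) (c ⊔ ℓ₁ ⊔ ℓ₂)
  𝕏 = torusImage edgeMonomials

  𝕏-coords#0 : ∀ e P → P ∈ 𝕏 → coords P e # 0#
  𝕏-coords#0 e P (t , t#0 , a , a#0 , P≈) =
    #-congʳ (sym (P≈ e)) (x#0y#0→xy#0 a#0 (x#0y#0→xy#0 (t#0 _) (t#0 _)))

  𝕐 : Pred (Point s) (c ⊔ ℓ₁ ⊔ ℓ₂)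
  𝕐 = torusImage {k} λ t e → t (block e)

  C𝕏 : .{{_ : NonZero s}} → ∀ {m} → Enumeration 𝕏 m → ℕ → LeftModule ring (c ⊔ ℓ₁) ℓ₁
  C𝕏 E d = submodule (code 𝕏 (𝕏-coords#0 (first s)) E d)

  -- H_ψ(d) = h
  Hψ : ℕ → ℕ → Set (c ⊔ ℓ₁ ⊔ ℓ₂)
  Hψ d h = HasDimension (vanishingIdealPart 𝕐 d / vanishingIdealPart 𝕏 d) h

{-# OPTIONS --safe #-}

-- Substituting X_i for every X_e with e in the block of odd i maps S_d/I_𝕏(d)
-- to the degree d piece of the coordinate ring of 𝕋.  It is well defined since
-- 𝕐 ⊆ 𝕏, its kernel is I_𝕐(d)/I_𝕏(d), and it is split by sending X_i to the
-- variable of the matching edge at odd i.  A basis of the middle term of this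
-- exact sequence is glued from bases of the outer ones, and f ↦ (f(P_i)/X₁^d(P_i))
-- identifies S_d/I_𝕏(d) with the code.  All these spaces are finite with
-- decidable equality, so bases are found greedily.
module Submission where

open import Algebra.Apartness.Bundles using (HeytingField; HeytingCommutativeRing)
import Algebra.Apartness.Properties.HeytingCommutativeRing as HCRProperties
open import Algebra.Bundles using (Ring; AbelianGroup; CommutativeRing; CommutativeSemiring)
open import Algebra.Module.Bundles using (LeftModule)
import Algebra.Properties.AbelianGroup as AbelianGroupProperties
import Algebra.Properties.CommutativeMonoid.Sum as CommutativeMonoidSum
import Algebra.Properties.CommutativeSemigroup as CommutativeSemigroupProperties
import Algebra.Properties.CommutativeSemiring.Exp as Exp
import Algebra.Properties.Ring as RingProperties
open import Data.Fin.Base as Fin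
  using (Fin; zero; suc; _↑ˡ_; _↑ʳ_; splitAt; finToFun; funToFin; remQuot; toℕ; fromℕ<)
import Data.Fin.Properties as Fin
open import Data.List.Base as List using ([]; _∷_; length; map)
open import Data.Nat.Base as ℕ using (ℕ; NonZero)
import Data.Nat.Properties as ℕ
open import Data.Product using (_×_; _,_; ∃; ∃-syntax; proj₁; proj₂)
open import Data.Sum.Base using (inj₁; inj₂)
open import Data.Sum.Properties using ([,]-map)
open import Data.Vec.Base as Vec using ([]; _∷_; lookup; zipWith; updateAt)
open import Data.Vec.Functional using (Vector; _++_)
open import Data.Vec.Functional.Properties using (lookup-++ˡ; lookup-++ʳ)
import Data.Vec.Properties as Vec
open import Function.Base using (_∘_; id)
open import Function.Bundles using (Inverse)
open import Level using (_⊔_)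
open import Relation.Binary.Definitions using (Decidable)
open import Relation.Binary.PropositionalEquality as ≡ using (_≡_; _≢_)
import Relation.Binary.Reasoning.Setoid as ≈-Reasoning
open import Relation.Nullary.Decidable using (Dec; yes; no; map′; _→-dec_; decidable-stable)
open import Relation.Nullary.Negation using (¬_; contradiction)
open import Relation.Unary using (Pred; _∈_)
import Relation.Unary as Unary
open import Defs

-- Membership in I_Z(d) is defined through generation, which cannot be tested directly. The way
-- around this is that a homogeneous `f` lies in the ideal exactly when `eval f (φ t)` is zero for
-- every `t` in the torus. Every equation between classes thereby becomes an equation between
-- values, and well-definedness, kernel and surjectivity of the substitution are all checked by
-- evaluation. Finiteness of K makes these conditions decidable, and decidability is what yields
-- bases constructively, in particular for I_𝕐(d)/I_𝕏(d), which comes with no generators. Since a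
-- polynomial is a list of terms with repetitions, compared by coefficients, evaluation itself has
-- to be shown to respect equality.

-- Linear combinations, linear maps and dimension in short exact sequences.

module LinearMaps {r ℓr} (R : Ring r ℓr) where
  open LinearAlgebra R
  private module R = Ring R

  module _ {m ℓm} (M : LeftModule R m ℓm) where
    open LeftModule M
    private
      module Σ = CommutativeMonoidSum (AbelianGroup.commutativeMonoid +ᴹ-abelianGroup)

    InSpan : ∀ {n} → Vector Carrierᴹ n → Carrierᴹ → Set (r ⊔ ℓm)
    InSpan v x = ∃[ a ] combination M a v ≈ᴹ x

    combination-cong : ∀ {n} {a b : Vector R.Carrier n} {v w : Vector Carrierᴹ n} →
                       (∀ i → a i R.≈ b i) → (∀ i → v i ≈ᴹ w i) →
                       combination M a v ≈ᴹ combination M b w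
    combination-cong a≈b v≈w = Σ.sum-cong-≋ (λ i → *ₗ-cong (a≈b i) (v≈w i))

    combination-zero : ∀ {n} {a : Vector R.Carrier n} (v : Vector Carrierᴹ n) →
                       (∀ i → a i R.≈ R.0#) → combination M a v ≈ᴹ 0ᴹ
    combination-zero {n} v a≈0 = ≈ᴹ-trans
      (Σ.sum-cong-≋ (λ i → ≈ᴹ-trans (*ₗ-cong (a≈0 i) ≈ᴹ-refl) (*ₗ-zeroˡ (v i))))
      (Σ.sum-replicate-zero n)

    combination-+ : ∀ {n} (a b : Vector R.Carrier n) (v : Vector Carrierᴹ n) →
                    combination M (λ i → a i R.+ b i) v ≈ᴹ combination M a v +ᴹ combination M b v
    combination-+ a b v = ≈ᴹ-trans
      (Σ.sum-cong-≋ (λ i → *ₗ-distribʳ (v i) (a i) (b i))) (Σ.∑-distrib-+ (λ i → a i *ₗ v i) (λ i → b i *ₗ v i))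

    combination-* : ∀ {n} c (a : Vector R.Carrier n) (v : Vector Carrierᴹ n) →
                    combination M (λ i → c R.* a i) v ≈ᴹ c *ₗ combination M a v
    combination-* {ℕ.zero}  c a v = ≈ᴹ-sym (*ₗ-zeroʳ c)
    combination-* {ℕ.suc n} c a v = ≈ᴹ-trans
      (+ᴹ-cong (*ₗ-assoc c (a zero) (v zero)) (combination-* c (a ∘ suc) (v ∘ suc)))
      (≈ᴹ-sym (*ₗ-distribˡ c _ _))

    combination-++ : ∀ {m n} (c : Vector R.Carrier (m ℕ.+ n))
                     (u : Vector Carrierᴹ m) (w : Vector Carrierᴹ n) →
                     combination M c (u ++ w) ≈ᴹ
                     combination M (c ∘ (_↑ˡ n)) u +ᴹ combination M (c ∘ (m ↑ʳ_)) w
    combination-++ {ℕ.zero}  c u w = ≈ᴹ-sym (+ᴹ-identityˡ _)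
    combination-++ {ℕ.suc m} {n} c u w = begin
      c zero *ₗ u zero +ᴹ combination M (c ∘ suc) ((u ++ w) ∘ suc)
        -- `(u ++ w) ∘ suc` and `(u ∘ suc) ++ w` agree only pointwise, because `splitAt` on a
        -- successor maps over its recursive result.
        ≈⟨ +ᴹ-congˡ (combination-cong (λ _ → R.refl)
             (λ i → ≡.subst ((u ++ w) (suc i) ≈ᴹ_) ([,]-map (splitAt m i)) ≈ᴹ-refl)) ⟩
      c zero *ₗ u zero +ᴹ combination M (c ∘ suc) ((u ∘ suc) ++ w)
        ≈⟨ +ᴹ-congˡ (combination-++ (c ∘ suc) (u ∘ suc) w) ⟩
      c zero *ₗ u zero +ᴹ (combination M (c ∘ suc ∘ (_↑ˡ n)) (u ∘ suc) +ᴹ combination M (c ∘ (ℕ.suc m ↑ʳ_)) w)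
        ≈⟨ +ᴹ-assoc _ _ _ ⟨
      combination M (c ∘ (_↑ˡ n)) u +ᴹ combination M (c ∘ (ℕ.suc m ↑ʳ_)) w ∎
      where open ≈-Reasoning ≈ᴹ-setoid

    module _ {n} (v : Vector Carrierᴹ n) where

      InSpan-resp : ∀ {x y} → x ≈ᴹ y → InSpan v x → InSpan v y
      InSpan-resp x≈y (a , a≈) = a , ≈ᴹ-trans a≈ x≈y

      InSpan-0 : InSpan v 0ᴹ
      InSpan-0 = (λ _ → R.0#) , combination-zero v (λ _ → R.refl)

      InSpan-+ : ∀ {x y} → InSpan v x → InSpan v y → InSpan v (x +ᴹ y)
      InSpan-+ (a , a≈) (b , b≈) = _ , ≈ᴹ-trans (combination-+ a b v) (+ᴹ-cong a≈ b≈)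

      InSpan-*ₗ : ∀ c {x} → InSpan v x → InSpan v (c *ₗ x)
      InSpan-*ₗ c (a , a≈) = _ , ≈ᴹ-trans (combination-* c a v) (*ₗ-cong R.refl a≈)

    InSpan-head : ∀ {n} (v : Vector Carrierᴹ (ℕ.suc n)) → InSpan v (v zero)
    InSpan-head v = (λ { zero → R.1# ; (suc _) → R.0# }) ,
      ≈ᴹ-trans (+ᴹ-cong (*ₗ-identityˡ _) (combination-zero (v ∘ suc) (λ _ → R.refl))) (+ᴹ-identityʳ _)

    InSpan-tail : ∀ {n} (v : Vector Carrierᴹ (ℕ.suc n)) {x} → InSpan (v ∘ suc) x → InSpan v x
    InSpan-tail v (a , a≈) = (λ { zero → R.0# ; (suc i) → a i }) ,
      ≈ᴹ-trans (+ᴹ-cong (*ₗ-zeroˡ _) a≈) (+ᴹ-identityˡ _)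

    InSpan-lookup : ∀ {n} (v : Vector Carrierᴹ n) i → InSpan v (v i)
    InSpan-lookup v zero    = InSpan-head v
    InSpan-lookup v (suc i) = InSpan-tail v (InSpan-lookup (v ∘ suc) i)

  record IsLinear {m ℓm n ℓn} (M : LeftModule R m ℓm) (N : LeftModule R n ℓn)
                  (φ : LeftModule.Carrierᴹ M → LeftModule.Carrierᴹ N) : Set (r ⊔ m ⊔ ℓm ⊔ ℓn) where
    private
      module M = LeftModule M
      module N = LeftModule N
    field
      cong    : ∀ {x y} → x M.≈ᴹ y → φ x N.≈ᴹ φ y
      +-homo  : ∀ x y → φ (x M.+ᴹ y) N.≈ᴹ φ x N.+ᴹ φ y
      *ₗ-homo : ∀ a x → φ (a M.*ₗ x) N.≈ᴹ a N.*ₗ φ x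

    0-homo : φ M.0ᴹ N.≈ᴹ N.0ᴹ
    0-homo = N.≈ᴹ-trans (cong (M.≈ᴹ-sym (M.*ₗ-zeroˡ M.0ᴹ)))
             (N.≈ᴹ-trans (*ₗ-homo R.0# M.0ᴹ) (N.*ₗ-zeroˡ _))

    combination-homo : ∀ {k} a (v : Vector M.Carrierᴹ k) →
                       φ (combination M a v) N.≈ᴹ combination N a (φ ∘ v)
    combination-homo {ℕ.zero}  a v = 0-homo
    combination-homo {ℕ.suc k} a v = N.≈ᴹ-trans (+-homo _ _)
      (N.+ᴹ-cong (*ₗ-homo _ _) (combination-homo (a ∘ suc) (v ∘ suc)))

  module _ {m ℓm n ℓn} {M : LeftModule R m ℓm} {N : LeftModule R n ℓn} where
    private
      module M = LeftModule M
      module N = LeftModule N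

    isomorphism-hasDimension :
      ∀ {φ : M.Carrierᴹ → N.Carrierᴹ} → IsLinear M N φ →
      (∀ x → φ x N.≈ᴹ N.0ᴹ → x M.≈ᴹ M.0ᴹ) → (∀ y → ∃[ x ] φ x N.≈ᴹ y) →
      ∀ {k} → HasDimension M k → HasDimension N k
    isomorphism-hasDimension {φ} φ-linear injective surjective (v , indep , span) =
      φ ∘ v ,
      (λ a eq → indep a (injective _ (N.≈ᴹ-trans (combination-homo a v) eq))) ,
      (λ y → let x , φx≈y = surjective y; a , a≈x = span x in
        a , N.≈ᴹ-trans (N.≈ᴹ-sym (combination-homo a v)) (N.≈ᴹ-trans (cong a≈x) φx≈y))
      where
      open IsLinear φ-linear

  module _ {m′ ℓm′ m ℓm m″ ℓm″} {M′ : LeftModule R m′ ℓm′} {M : LeftModule R m ℓm}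
           {M″ : LeftModule R m″ ℓm″} where
    private
      module M′ = LeftModule M′
      module M″ = LeftModule M″
    open LeftModule M

    -- The basis is `ι ∘ u` followed by lifts of `w`. Independence: `π` kills the first part of a
    -- relation, so the coefficients of the lifts vanish, and injectivity of `ι` settles the rest.
    -- Spanning: subtracting from `x` the lifted combination that represents `π x` leaves an element
    -- of the kernel, hence of the image of `ι`.
    extension-hasDimension :
      ∀ {ι : M′.Carrierᴹ → Carrierᴹ} {π : Carrierᴹ → M″.Carrierᴹ} →
      IsLinear M′ M ι → IsLinear M M″ π →
      (∀ x → ι x ≈ᴹ 0ᴹ → x M′.≈ᴹ M′.0ᴹ) →
      (∀ x → π (ι x) M″.≈ᴹ M″.0ᴹ) →
      (∀ y → π y M″.≈ᴹ M″.0ᴹ → ∃[ x ] ι x ≈ᴹ y) →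
      (∀ z → ∃[ y ] π y M″.≈ᴹ z) →
      ∀ {k l} → HasDimension M′ k → HasDimension M″ l → HasDimension M (k ℕ.+ l)
    extension-hasDimension {ι} {π} ι-linear π-linear injective complex exact surjective
      {k} {l} (u , u-indep , u-span) (w , w-indep , w-span) = ι ∘ u ++ w̃ , indep , span
      where
      module ι = IsLinear ι-linear
      module π = IsLinear π-linear

      w̃ : Vector Carrierᴹ l
      w̃ = proj₁ ∘ surjective ∘ w

      π-w̃ : ∀ b → π (combination M b w̃) M″.≈ᴹ combination M″ b w
      π-w̃ b = M″.≈ᴹ-trans (π.combination-homo b w̃)
        (combination-cong M″ (λ _ → R.refl) (proj₂ ∘ surjective ∘ w))

      indep : LinearlyIndependent M (ι ∘ u ++ w̃)
      indep c eq i = ≡.subst (λ j → c j R.≈ R.0#) (Fin.join-splitAt k l i) (at (splitAt k i))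
        where
        c₁ = c ∘ (_↑ˡ l)
        c₂ = c ∘ (k ↑ʳ_)
        split : ι (combination M′ c₁ u) +ᴹ combination M c₂ w̃ ≈ᴹ 0ᴹ
        split = ≈ᴹ-trans (+ᴹ-cong (ι.combination-homo c₁ u) ≈ᴹ-refl)
          (≈ᴹ-trans (≈ᴹ-sym (combination-++ M c (ι ∘ u) w̃)) eq)
        c₂≈0 : ∀ j → c₂ j R.≈ R.0#
        c₂≈0 = w-indep c₂ (begin
          combination M″ c₂ w                                     ≈⟨ π-w̃ c₂ ⟨
          π (combination M c₂ w̃)                                  ≈⟨ M″.+ᴹ-identityˡ _ ⟨
          M″.0ᴹ M″.+ᴹ π (combination M c₂ w̃)                      ≈⟨ M″.+ᴹ-cong (complex _) M″.≈ᴹ-refl ⟨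
          π (ι (combination M′ c₁ u)) M″.+ᴹ π (combination M c₂ w̃) ≈⟨ π.+-homo _ _ ⟨
          π (ι (combination M′ c₁ u) +ᴹ combination M c₂ w̃)       ≈⟨ π.cong split ⟩
          π 0ᴹ                                                    ≈⟨ π.0-homo ⟩
          M″.0ᴹ                                                   ∎)
          where open ≈-Reasoning M″.≈ᴹ-setoid
        c₁≈0 : ∀ j → c₁ j R.≈ R.0#
        c₁≈0 = u-indep c₁ (injective _ (begin
          ι (combination M′ c₁ u)                          ≈⟨ +ᴹ-identityʳ _ ⟨
          ι (combination M′ c₁ u) +ᴹ 0ᴹ                    ≈⟨ +ᴹ-congˡ (combination-zero M w̃ c₂≈0) ⟨
          ι (combination M′ c₁ u) +ᴹ combination M c₂ w̃    ≈⟨ split ⟩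
          0ᴹ                                               ∎))
          where open ≈-Reasoning ≈ᴹ-setoid
        at : ∀ j → c (Fin.join k l j) R.≈ R.0#
        at (inj₁ j) = c₁≈0 j
        at (inj₂ j) = c₂≈0 j

      span : Spanning M (ι ∘ u ++ w̃)
      span x = a ++ b , (begin
        combination M (a ++ b) (ι ∘ u ++ w̃)
          ≈⟨ combination-++ M (a ++ b) (ι ∘ u) w̃ ⟩
        combination M ((a ++ b) ∘ (_↑ˡ l)) (ι ∘ u) +ᴹ combination M ((a ++ b) ∘ (k ↑ʳ_)) w̃
          ≈⟨ +ᴹ-cong (combination-cong M (λ i → R.reflexive (lookup-++ˡ a b i)) (λ _ → ≈ᴹ-refl))
                     (combination-cong M (λ i → R.reflexive (lookup-++ʳ a b i)) (λ _ → ≈ᴹ-refl)) ⟩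
        combination M a (ι ∘ u) +ᴹ combination M b w̃
          ≈⟨ +ᴹ-cong (ι.combination-homo a u) ≈ᴹ-refl ⟨
        ι (combination M′ a u) +ᴹ combination M b w̃
          ≈⟨ +ᴹ-cong (≈ᴹ-trans (ι.cong (proj₂ (u-span y))) (proj₂ preimage)) ≈ᴹ-refl ⟩
        (x +ᴹ -1b) +ᴹ combination M b w̃
          ≈⟨ +ᴹ-assoc _ _ _ ⟩
        x +ᴹ (-1b +ᴹ combination M b w̃)
          ≈⟨ +ᴹ-congˡ (+ᴹ-cong (-1*x≈-x {M = M} _) ≈ᴹ-refl) ⟩
        x +ᴹ (-ᴹ combination M b w̃ +ᴹ combination M b w̃)
          ≈⟨ +ᴹ-congˡ (-ᴹ‿inverseˡ _) ⟩
        x +ᴹ 0ᴹ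
          ≈⟨ +ᴹ-identityʳ x ⟩
        x ∎)
        where
        open ≈-Reasoning ≈ᴹ-setoid
        b = proj₁ (w-span (π x))
        -- The negative is written as a scalar multiple because `IsLinear` speaks only of sums and
        -- scalars.
        -1b = (R.- R.1#) *ₗ combination M b w̃
        -1b∈ker : π (x +ᴹ -1b) M″.≈ᴹ M″.0ᴹ
        -1b∈ker = M″.≈ᴹ-trans (π.+-homo _ _)
          (M″.≈ᴹ-trans (M″.+ᴹ-cong (M″.≈ᴹ-sym (proj₂ (w-span (π x))))
                         (M″.≈ᴹ-trans (π.*ₗ-homo _ _)
                           (M″.≈ᴹ-trans (-1*x≈-x {M = M″} _) (M″.-ᴹ‿cong (π-w̃ b)))))
                       (M″.-ᴹ‿inverseʳ _))
        preimage = exact (x +ᴹ -1b) -1b∈ker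
        y = proj₁ preimage
        a = proj₁ (u-span y)

-- Finite fields: exhaustive search, decidable apartness and greedy bases.

module FiniteField {c ℓ₁ ℓ₂} (K : HeytingField c ℓ₁ ℓ₂) {q : ℕ} (order : HasOrder K q) where
  open HeytingField K hiding (zero)
  open HCRProperties heytingCommutativeRing using (invertibleˡ⇒#; #-congʳ)
  open OverField K
  open LinearMaps ring
  private
    module order = Inverse order

  infix 4 _≟_
  _≟_ : Decidable _≈_
  x ≟ y = map′ (λ eq → trans (sym (order.strictlyInverseʳ x))
                 (trans (order.from-cong eq) (order.strictlyInverseʳ y)))
               order.to-cong (order.to x Fin.≟ order.to y)

  vector : ∀ n → Fin (q ℕ.^ n) → Vector Carrier n
  vector n i j = order.from (finToFun i j)

  vector-surjective : ∀ {n} (x : Vector Carrier n) → ∃[ i ] ∀ j → vector n i j ≈ x j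
  vector-surjective x = funToFin (order.to ∘ x) , λ j →
    trans (order.from-cong (Fin.finToFun-funToFin (order.to ∘ x) j)) (order.strictlyInverseʳ (x j))

  module _ {n p} {P : Pred (Vector Carrier n) p}
           (P-resp : ∀ {x y} → (∀ i → x i ≈ y i) → P x → P y) (P? : Unary.Decidable P) where

    -- `vector` reaches every vector only up to `_≈_`, so a search over its indices decides the
    -- question once `P` respects pointwise equality.
    anyVector? : Dec (∃ P)
    anyVector? = map′ (λ (i , Pi) → vector n i , Pi)
      (λ (x , Px) → let i , eq = vector-surjective x in i , P-resp (sym ∘ eq) Px)
      (Fin.any? (P? ∘ vector n))

    allVectors? : Dec (∀ x → P x)
    allVectors? = map′ (λ all x → let i , eq = vector-surjective x in P-resp eq (all i))
      (λ all i → all (vector n i)) (Fin.all? (P? ∘ vector n))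

  -- In a Heyting field, apartness from zero amounts to invertibility of `x - 0#`, and an inverse
  -- can be searched for. The candidate is passed as a vector of length one.
  invertibleˡ? : ∀ x → Dec (∃[ y ] y * (x - 0#) ≈ 1#)
  invertibleˡ? x = map′ (λ (v , eq) → v zero , eq) (λ (y , eq) → (λ _ → y) , eq)
    (anyVector? {1} {P = λ v → v zero * (x - 0#) ≈ 1#}
      (λ v≈w eq → trans (*-congʳ (sym (v≈w zero))) eq) (λ _ → _ ≟ _))

  _#0? : ∀ x → Dec (x # 0#)
  x #0? = map′ invertibleˡ⇒# (λ x#0 → let y , eq , _ = #⇒invertible x#0 in y , eq) (invertibleˡ? x)

  -- Tightness alone yields only the double negation of apartness; decidability removes it.
  ≉0⇒#0 : ∀ {x} → ¬ x ≈ 0# → x # 0#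
  ≉0⇒#0 x≉0 = decidable-stable (_ #0?) (x≉0 ∘ proj₁ (tight _ _))

  module _ {m ℓm} (M : LeftModule ring m ℓm) (_≟ᴹ_ : Decidable (LeftModule._≈ᴹ_ M)) where
    open LeftModule M
    open AbelianGroupProperties +ᴹ-abelianGroup using (inverseˡ-unique)

    inSpan? : ∀ {n} (v : Vector Carrierᴹ n) x → Dec (InSpan M v x)
    inSpan? v x = anyVector?
      (λ a≈b eq → ≈ᴹ-trans (combination-cong M (sym ∘ a≈b) (λ _ → ≈ᴹ-refl)) eq)
      (λ _ → _ ≟ᴹ _)

    -- A relation with nonzero leading coefficient could be solved for `v zero`, placing it in the
    -- span of the others.
    independent-extend : ∀ {n} (v : Vector Carrierᴹ (ℕ.suc n)) →
                         LinearlyIndependent M (v ∘ suc) → ¬ InSpan M (v ∘ suc) (v zero) →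
                         LinearlyIndependent M v
    independent-extend v indep v₀∉span a eq with a zero ≟ 0#
    ... | yes a₀≈0 = λ { zero → a₀≈0 ; (suc i) → indep (a ∘ suc) (begin
        combination M (a ∘ suc) (v ∘ suc)                        ≈⟨ +ᴹ-identityˡ _ ⟨
        0ᴹ +ᴹ combination M (a ∘ suc) (v ∘ suc)                  ≈⟨ +ᴹ-cong (*ₗ-zeroˡ (v zero)) ≈ᴹ-refl ⟨
        0# *ₗ v zero +ᴹ combination M (a ∘ suc) (v ∘ suc)        ≈⟨ +ᴹ-cong (*ₗ-cong a₀≈0 ≈ᴹ-refl) ≈ᴹ-refl ⟨
        a zero *ₗ v zero +ᴹ combination M (a ∘ suc) (v ∘ suc)    ≈⟨ eq ⟩
        0ᴹ                                                       ∎) i }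
      where open ≈-Reasoning ≈ᴹ-setoid
    ... | no  a₀≉0 = contradiction
        (InSpan-resp M (v ∘ suc) (begin
          a₀⁻¹ *ₗ ((- 1#) *ₗ rest)       ≈⟨ *ₗ-cong refl (-1*x≈-x {M = M} rest) ⟩
          a₀⁻¹ *ₗ (-ᴹ rest)              ≈⟨ *ₗ-cong refl (inverseˡ-unique _ _ eq) ⟨
          a₀⁻¹ *ₗ (a zero *ₗ v zero)     ≈⟨ *ₗ-assoc _ _ _ ⟨
          (a₀⁻¹ * a zero) *ₗ v zero      ≈⟨ *ₗ-cong (*-congˡ (x-0≈x _)) ≈ᴹ-refl ⟨
          (a₀⁻¹ * (a zero - 0#)) *ₗ v zero ≈⟨ *ₗ-cong (proj₁ (proj₂ inverse)) ≈ᴹ-refl ⟩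
          1# *ₗ v zero                   ≈⟨ *ₗ-identityˡ _ ⟩
          v zero                         ∎)
          (InSpan-*ₗ M (v ∘ suc) a₀⁻¹ (InSpan-*ₗ M (v ∘ suc) (- 1#) (a ∘ suc , ≈ᴹ-refl))))
        v₀∉span
      where
      open ≈-Reasoning ≈ᴹ-setoid
      open HCRProperties heytingCommutativeRing using (x-0≈x)
      inverse = #⇒invertible (≉0⇒#0 a₀≉0)
      a₀⁻¹ = proj₁ inverse
      rest = combination M (a ∘ suc) (v ∘ suc)

    independent-family : ∀ {N} (x : Vector Carrierᴹ N) →
      ∃[ n ] ∃[ v ] LinearlyIndependent M {n} v × (∀ i → InSpan M v (x i))
    independent-family {ℕ.zero}  x = 0 , (λ ()) , (λ _ _ ()) , λ ()
    independent-family {ℕ.suc N} x with independent-family (x ∘ suc)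
    ... | n , v , indep , spans with inSpan? v (x zero)
    ...   | yes x₀∈span = n , v , indep , λ { zero → x₀∈span ; (suc i) → spans i }
    ...   | no  x₀∉span = ℕ.suc n , v′ , independent-extend v′ indep x₀∉span ,
              λ { zero → InSpan-head M v′ ; (suc i) → InSpan-tail M v′ (spans i) }
      where
      v′ : Vector Carrierᴹ (ℕ.suc n)
      v′ zero    = x zero
      v′ (suc i) = v i

    -- The family lists all elements rather than generators: for the ideal parts no generators are
    -- at hand, but their elements can be filtered out of an enumeration of the graded piece.
    covered⇒hasDimension : ∀ {N} (x : Vector Carrierᴹ N) → (∀ y → ∃[ i ] x i ≈ᴹ y) →
                           ∃[ n ] HasDimension M n
    covered⇒hasDimension x covers with independent-family x
    ... | n , v , indep , spans = n , v , indep , λ y →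
      let i , xᵢ≈y = covers y in InSpan-resp M v xᵢ≈y (spans i)

-- Exponent vectors under a substitution of variables.

-- The effect of X_e ↦ X_{b e} on exponents: entries are summed along the fibres of `b`.
push : ∀ {s k} → (Fin s → Fin k) → Vec.Vec ℕ s → Vec.Vec ℕ k
push {k = k} b []       = Vec.replicate k 0
push         b (x ∷ xs) = updateAt (push (b ∘ suc) xs) (b zero) (x ℕ.+_)

sum-updateAt-+ : ∀ {k} (v : Vec.Vec ℕ k) j x → Vec.sum (updateAt v j (x ℕ.+_)) ≡ x ℕ.+ Vec.sum v
sum-updateAt-+ (y ∷ v) zero    x = ℕ.+-assoc x y (Vec.sum v)
sum-updateAt-+ (y ∷ v) (suc j) x = ≡.trans (≡.cong (y ℕ.+_) (sum-updateAt-+ v j x)) (x∙yz≈y∙xz y x (Vec.sum v))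
  where open CommutativeSemigroupProperties ℕ.+-commutativeSemigroup using (x∙yz≈y∙xz)

sum-replicate-0 : ∀ k → Vec.sum (Vec.replicate k 0) ≡ 0
sum-replicate-0 ℕ.zero    = ≡.refl
sum-replicate-0 (ℕ.suc k) = sum-replicate-0 k

sum-push : ∀ {s k} (b : Fin s → Fin k) e → Vec.sum (push b e) ≡ Vec.sum e
sum-push {k = k} b []       = sum-replicate-0 k
sum-push         b (x ∷ xs) = ≡.trans (sum-updateAt-+ (push (b ∘ suc) xs) (b zero) x)
  (≡.cong (x ℕ.+_) (sum-push (b ∘ suc) xs))

-- Lets an exponent vector of degree d be read as a string of digits in base d+1.
lookup≤sum : ∀ {k} (v : Vec.Vec ℕ k) i → lookup v i ℕ.≤ Vec.sum v
lookup≤sum (x ∷ v) zero    = ℕ.m≤m+n x (Vec.sum v)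
lookup≤sum (x ∷ v) (suc i) = ℕ.≤-trans (lookup≤sum v i) (ℕ.m≤n+m (Vec.sum v) x)

-- Evaluation of polynomials and vanishing ideals.

module Polynomials {c ℓ₁ ℓ₂} (K : HeytingField c ℓ₁ ℓ₂) where
  open HeytingField K hiding (zero)
  private
    commutativeRing : CommutativeRing c ℓ₁
    commutativeRing = HeytingCommutativeRing.commutativeRing heytingCommutativeRing
  open CommutativeRing commutativeRing
    using (commutativeSemiring; +-commutativeSemigroup; *-commutativeSemigroup)
  open import Algebra.Definitions.RawSemiring (CommutativeSemiring.rawSemiring commutativeSemiring) using (_^_; product)
  open Exp commutativeSemiring using (^-homo-*; ^-distrib-*; ^-congˡ)
  open HCRProperties heytingCommutativeRing using (1#0; x#0y#0→xy#0; #-congʳ)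
  open OverField K
  open LinearMaps ring
  open RingProperties ring using (-‿distribˡ-*; -0#≈0#; -‿+-comm; x∙y⁻¹≈ε⇒x≈y; x≈y⇒x∙y⁻¹≈ε)
  private
    module +S = CommutativeSemigroupProperties +-commutativeSemigroup
    module *S = CommutativeSemigroupProperties *-commutativeSemigroup
    module ∏ = CommutativeMonoidSum (CommutativeRing.*-commutativeMonoid commutativeRing)

  _≟ᵉ_ : ∀ {r} → Decidable (_≡_ {A = Exponent r})
  _≟ᵉ_ = Vec.≡-dec ℕ._≟_

  monomial : ∀ {r} → Vector Carrier r → Exponent r → Carrier
  monomial x e = product (λ i → x i ^ lookup e i)

  module _ {r : ℕ} where

    -- The linear functional with value `L e` on the monomial X^e. By definition `eval p x` is the
    -- case `L = monomial x`, and reading off a coefficient is another instance.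
    linear : (Exponent r → Carrier) → Poly r → Carrier
    linear L = List.foldr (λ (a , e) b → a * L e + b) 0#

    -- Striking every term with exponent `e` at once, repetitions included, isolates the full
    -- coefficient at `e`.
    remove : Exponent r → Poly r → Poly r
    remove e []             = []
    remove e ((a , e′) ∷ p) with e ≟ᵉ e′
    ... | yes _ = remove e p
    ... | no  _ = (a , e′) ∷ remove e p

    length-remove : ∀ e p → length (remove e p) ℕ.≤ length p
    length-remove e []             = ℕ.z≤n
    length-remove e ((a , e′) ∷ p) with e ≟ᵉ e′
    ... | yes _ = ℕ.m≤n⇒m≤1+n (length-remove e p)
    ... | no  _ = ℕ.s≤s (length-remove e p)

    length-remove-head : ∀ {a} e p → length (remove e ((a , e) ∷ p)) ℕ.≤ length p
    length-remove-head e p with e ≟ᵉ e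
    ... | yes _  = length-remove e p
    ... | no e≢e = contradiction ≡.refl e≢e

    coeff-remove-≡ : ∀ e p → coeff (remove e p) e ≡ 0#
    coeff-remove-≡ e []             = ≡.refl
    coeff-remove-≡ e ((a , e′) ∷ p) with e ≟ᵉ e′ in eq
    ... | yes _ = coeff-remove-≡ e p
    ... | no  _ rewrite eq = coeff-remove-≡ e p

    coeff-remove-≢ : ∀ e p {e′} → e′ ≢ e → coeff (remove e p) e′ ≡ coeff p e′
    coeff-remove-≢ e []             {e′} e′≢e = ≡.refl
    coeff-remove-≢ e ((a , e″) ∷ p) {e′} e′≢e with e ≟ᵉ e″
    coeff-remove-≢ e ((a , e) ∷ p) {e′} e′≢e | yes ≡.refl with e′ ≟ᵉ e
    ... | yes e′≡e = contradiction e′≡e e′≢e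
    ... | no  _    = coeff-remove-≢ e p e′≢e
    coeff-remove-≢ e ((a , e″) ∷ p) {e′} e′≢e | no _ with e′ ≟ᵉ e″
    ... | yes _ = ≡.cong (a +_) (coeff-remove-≢ e p e′≢e)
    ... | no  _ = coeff-remove-≢ e p e′≢e

    linear-remove : ∀ L e p → linear L p ≈ coeff p e * L e + linear L (remove e p)
    linear-remove L e []             = sym (trans (+-identityʳ _) (zeroˡ _))
    linear-remove L e ((a , e′) ∷ p) with e ≟ᵉ e′
    ... | yes ≡.refl = trans (+-congˡ (linear-remove L e p))
                         (trans (sym (+-assoc _ _ _)) (+-congʳ (sym (distribʳ _ _ _))))
    ... | no  _      = trans (+-congˡ (linear-remove L e p)) (+S.x∙yz≈y∙xz _ _ _)

    private
      -- Removing the exponent of a head term from both lists strictly lowers their total length,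
      -- while the removed contributions agree by assumption. The recursion is not structural, hence
      -- the bound `n`.
      linear-cong′ : ∀ {L L′} n p q → length p ℕ.+ length q ℕ.≤ n →
                     (∀ e → coeff p e * L e ≈ coeff q e * L′ e) → linear L p ≈ linear L′ q
      linear-cong′ {L} {L′} = go
        where
        removed : ∀ p q → (∀ e → coeff p e * L e ≈ coeff q e * L′ e) →
                  ∀ e e′ → coeff (remove e p) e′ * L e′ ≈ coeff (remove e q) e′ * L′ e′
        removed p q p≈q e e′ with e′ ≟ᵉ e
        ... | yes ≡.refl rewrite coeff-remove-≡ e p | coeff-remove-≡ e q = trans (zeroˡ _) (sym (zeroˡ _))
        ... | no  e′≢e   rewrite coeff-remove-≢ e p e′≢e | coeff-remove-≢ e q e′≢e = p≈q e′
        go : ∀ n p q → length p ℕ.+ length q ℕ.≤ n →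
             (∀ e → coeff p e * L e ≈ coeff q e * L′ e) → linear L p ≈ linear L′ q
        step : ∀ n p q e → length (remove e p) ℕ.+ length (remove e q) ℕ.≤ n →
               (∀ e → coeff p e * L e ≈ coeff q e * L′ e) → linear L p ≈ linear L′ q
        go n         []                []                p+q≤n p≈q = refl
        go (ℕ.suc n) []                q@((_ , e) ∷ q′)  (ℕ.s≤s q≤n) p≈q =
          step n [] q e (ℕ.≤-trans (length-remove-head e q′) q≤n) p≈q
        go (ℕ.suc n) p@((_ , e) ∷ p′)  q                 (ℕ.s≤s p+q≤n) p≈q =
          step n p q e (ℕ.≤-trans (ℕ.+-mono-≤ (length-remove-head e p′) (length-remove e q)) p+q≤n) p≈q
        step n p q e le p≈q = trans (linear-remove L e p)
          (trans (+-cong (p≈q e) (go n (remove e p) (remove e q) le (removed p q p≈q e)))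
                 (sym (linear-remove L′ e q)))

    -- With L = L′ this says that linear L depends only on the coefficients; with
    -- p = q homogeneous, that only the values of L in degree d matter.
    linear-cong : ∀ {L L′} p q → (∀ e → coeff p e * L e ≈ coeff q e * L′ e) → linear L p ≈ linear L′ q
    linear-cong p q = linear-cong′ (length p ℕ.+ length q) p q ℕ.≤-refl

    linear-* : ∀ a L p → linear (λ e → a * L e) p ≈ a * linear L p
    linear-* a L []            = sym (zeroʳ a)
    linear-* a L ((b , e) ∷ p) = trans (+-cong (*S.x∙yz≈y∙xz b a (L e)) (linear-* a L p))
                                       (sym (distribˡ a _ _))

    eval-cong : ∀ (p q : Poly r) x → (∀ e → coeff p e ≈ coeff q e) → eval p x ≈ eval q x
    eval-cong p q x p≈q = linear-cong p q (λ e → *-congʳ (p≈q e))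

    eval-congʳ : ∀ (p : Poly r) {x y} → (∀ i → x i ≈ y i) → eval p x ≈ eval p y
    eval-congʳ p x≈y = linear-cong p p
      (λ e → *-congˡ (∏.sum-cong-≋ (λ i → ^-congˡ (lookup e i) (x≈y i))))

    eval-neg : ∀ (p : Poly r) x → eval (negᴾ p) x ≈ - eval p x
    eval-neg []            x = sym -0#≈0#
    eval-neg ((a , e) ∷ p) x = trans (+-cong (sym (-‿distribˡ-* a _)) (eval-neg p x)) (-‿+-comm _ _)

  monomial-zero : ∀ {r} (x : Vector Carrier r) → monomial x (Vec.replicate r 0) ≈ 1#
  monomial-zero {ℕ.zero}  x = refl
  monomial-zero {ℕ.suc r} x = trans (*-identityˡ _) (monomial-zero (x ∘ suc))

  monomial-+ : ∀ {r} (x : Vector Carrier r) e e′ →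
               monomial x (zipWith ℕ._+_ e e′) ≈ monomial x e * monomial x e′
  monomial-+ x []      []        = sym (*-identityˡ 1#)
  monomial-+ x (n ∷ e) (n′ ∷ e′) =
    trans (*-cong (^-homo-* (x zero) n n′) (monomial-+ (x ∘ suc) e e′)) (*S.interchange _ _ _ _)

  monomial-scale : ∀ {r} a (x : Vector Carrier r) e →
                   monomial (λ i → a * x i) e ≈ a ^ Vec.sum e * monomial x e
  monomial-scale a x []      = sym (*-identityˡ 1#)
  monomial-scale a x (n ∷ e) = begin
    (a * x zero) ^ n * monomial (λ i → a * x (suc i)) e
      ≈⟨ *-cong (^-distrib-* a (x zero) n) (monomial-scale a (x ∘ suc) e) ⟩
    (a ^ n * x zero ^ n) * (a ^ Vec.sum e * monomial (x ∘ suc) e)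
      ≈⟨ *S.interchange _ _ _ _ ⟩
    (a ^ n * a ^ Vec.sum e) * (x zero ^ n * monomial (x ∘ suc) e)
      ≈⟨ *-congʳ (^-homo-* a n (Vec.sum e)) ⟨
    a ^ (n ℕ.+ Vec.sum e) * (x zero ^ n * monomial (x ∘ suc) e) ∎
    where open ≈-Reasoning setoid

  monomial-updateAt-+ : ∀ {r} (x : Vector Carrier r) e j n →
                        monomial x (updateAt e j (n ℕ.+_)) ≈ x j ^ n * monomial x e
  monomial-updateAt-+ x (m ∷ e) zero    n = trans (*-congʳ (^-homo-* (x zero) n m)) (*-assoc _ _ _)
  monomial-updateAt-+ x (m ∷ e) (suc j) n =
    trans (*-congˡ (monomial-updateAt-+ (x ∘ suc) e j n)) (*S.x∙yz≈y∙xz _ _ _)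

  monomial-push : ∀ {s k} (b : Fin s → Fin k) (t : Vector Carrier k) e →
                  monomial t (push b e) ≈ monomial (t ∘ b) e
  monomial-push b t []      = monomial-zero t
  monomial-push b t (n ∷ e) =
    trans (monomial-updateAt-+ t (push (b ∘ suc) e) (b zero) n) (*-congˡ (monomial-push (b ∘ suc) t e))

  eval-* : ∀ {r} (p q : Poly r) x → eval (p *ᴾ q) x ≈ eval p x * eval q x
  eval-* []            q x = sym (zeroˡ _)
  eval-* ((a , e) ∷ p) q x = begin
    eval (term q List.++ p *ᴾ q) x                    ≈⟨ eval-++ (term q) (p *ᴾ q) x ⟩
    eval (term q) x + eval (p *ᴾ q) x                 ≈⟨ +-cong (eval-term q) (eval-* p q x) ⟩
    a * monomial x e * eval q x + eval p x * eval q x ≈⟨ distribʳ _ _ _ ⟨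
    eval ((a , e) ∷ p) x * eval q x                   ∎
    where
    open ≈-Reasoning setoid
    term : Poly _ → Poly _
    term = map (λ (b , e′) → a * b , zipWith ℕ._+_ e e′)
    eval-term : ∀ q → eval (term q) x ≈ a * monomial x e * eval q x
    eval-term []             = sym (zeroʳ _)
    eval-term ((b , e′) ∷ q) = trans
      (+-cong (trans (*-congˡ (monomial-+ x e e′)) (*S.interchange _ _ _ _)) (eval-term q))
      (sym (distribˡ _ _ _))

  Homogeneous : ∀ {r} → ℕ → Poly r → Set ℓ₁
  Homogeneous {r} d = Submodule.Member (homogeneous r d)

  -- Homogeneity constrains coefficients, not listed terms: terms of another degree may occur if
  -- they cancel. The comparison therefore goes through `linear-cong`, where wrong degrees carry
  -- coefficient zero.
  eval-homogeneous : ∀ {r d} (f : Poly r) → Homogeneous d f → ∀ a x →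
                     eval f (λ i → a * x i) ≈ a ^ d * eval f x
  eval-homogeneous {r} {d} f hf a x = trans
    (linear-cong f f λ e → termwise e (Vec.sum e ℕ.≟ d))
    (linear-* (a ^ d) (monomial x) f)
    where
    termwise : ∀ e → Dec (Vec.sum e ≡ d) →
               coeff f e * monomial (λ i → a * x i) e ≈ coeff f e * (a ^ d * monomial x e)
    termwise e (yes ≡.refl) = *-congˡ (monomial-scale a x e)
    termwise e (no  e≢d)    = trans (trans (*-congʳ (hf e e≢d)) (zeroˡ _))
                                    (sym (trans (*-congʳ (hf e e≢d)) (zeroˡ _)))

  mapExponents : ∀ {r r′} → (Exponent r → Exponent r′) → Poly r → Poly r′
  mapExponents h = map (λ (a , e) → a , h e)

  private
    indicator : ∀ {r} → Exponent r → Exponent r → Carrier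
    indicator e e′ with e ≟ᵉ e′
    ... | yes _ = 1#
    ... | no  _ = 0#

    -- Although `h` may merge exponents, a coefficient of the image is still a linear functional of
    -- `p`, which makes `linear-cong` applicable.
    coeff-mapExponents : ∀ {r r′} (h : Exponent r → Exponent r′) p e →
                         coeff (mapExponents h p) e ≈ linear (indicator e ∘ h) p
    coeff-mapExponents h []             e = refl
    coeff-mapExponents h ((a , e′) ∷ p) e with e ≟ᵉ h e′
    ... | yes _ = +-cong (sym (*-identityʳ a)) (coeff-mapExponents h p e)
    ... | no  _ = trans (sym (+-identityˡ _)) (+-cong (sym (zeroʳ a)) (coeff-mapExponents h p e))

  homogeneous-mapExponents : ∀ {r r′ d} (h : Exponent r → Exponent r′) →
                             (∀ e → Vec.sum (h e) ≡ Vec.sum e) →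
                             ∀ f → Homogeneous d f → Homogeneous d (mapExponents h f)
  homogeneous-mapExponents {d = d} h sum-h f hf e e≢d =
    trans (coeff-mapExponents h f e)
      -- Comparison with the empty list shows that the functional vanishes on `f`.
      (linear-cong {L′ = λ _ → 0#} f [] λ e′ → trans (vanish e′ (Vec.sum e′ ℕ.≟ d)) (sym (zeroʳ 0#)))
    where
    vanish : ∀ e′ → Dec (Vec.sum e′ ≡ d) → coeff f e′ * indicator e (h e′) ≈ 0#
    vanish e′ (no  e′≢d) = trans (*-congʳ (hf e′ e′≢d)) (zeroˡ _)
    vanish e′ (yes e′≡d) with e ≟ᵉ h e′
    ... | yes ≡.refl = contradiction (≡.trans (sum-h e′) e′≡d) e≢d
    ... | no  _      = zeroʳ _

  eval-mapExponents-push : ∀ {s k} (b : Fin s → Fin k) f t →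
                           eval (mapExponents (push b) f) t ≈ eval f (t ∘ b)
  eval-mapExponents-push b []            t = refl
  eval-mapExponents-push b ((a , e) ∷ f) t =
    +-cong (*-congˡ (monomial-push b t e)) (eval-mapExponents-push b f t)

  Generated⇒vanishing : ∀ {r p} {Z : Pred (Point r) p} {f} → f ∈ Generated (VanishingOn Z) →
                        ∀ P → P ∈ Z → eval f (coords P) ≈ 0#
  Generated⇒vanishing (gen (_ , f≈0))     P P∈Z = f≈0 P P∈Z
  Generated⇒vanishing 0∈                  P P∈Z = refl
  Generated⇒vanishing (+∈ {f} {g} f∈ g∈)  P P∈Z = trans (eval-++ f g _)
    (trans (+-cong (Generated⇒vanishing f∈ P P∈Z) (Generated⇒vanishing g∈ P P∈Z)) (+-identityˡ 0#))
  Generated⇒vanishing (*∈ g {f} f∈)       P P∈Z = trans (eval-* g f _)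
    (trans (*-congˡ (Generated⇒vanishing f∈ P P∈Z)) (zeroʳ _))
  Generated⇒vanishing (resp-≈ {f} {g} f≈g f∈) P P∈Z =
    trans (sym (eval-cong f g _ f≈g)) (Generated⇒vanishing f∈ P P∈Z)

  -- Tests only the representatives `φ t`, not all coordinate vectors of the points; for homogeneous
  -- `f` the two agree, since rescaling multiplies the value by a power of the scalar.
  VanishesAlong : ∀ {n r} → (Vector Carrier n → Vector Carrier r) → Poly r → Set (c ⊔ ℓ₁ ⊔ ℓ₂)
  VanishesAlong φ f = ∀ t → (∀ i → t i # 0#) → eval f (φ t) ≈ 0#

  module _ {n r} .{{_ : NonZero r}} (φ : Vector Carrier n → Vector Carrier r)
           (φ#0 : ∀ t → (∀ i → t i # 0#) → ∀ i → φ t i # 0#) where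

    torusPoint : ∀ t → (∀ i → t i # 0#) → Point r
    torusPoint t t#0 = record { coords = φ t ; nonzero = first r , φ#0 t t#0 (first r) }

    torusPoint∈ : ∀ t t#0 → torusPoint t t#0 ∈ torusImage φ
    torusPoint∈ t t#0 = t , t#0 , 1# , 1#0 , λ i → sym (*-identityˡ _)

    vanishingIdeal⇒ : ∀ {f} → f ∈ Generated (VanishingOn (torusImage φ)) → VanishesAlong φ f
    vanishingIdeal⇒ f∈ t t#0 = Generated⇒vanishing f∈ (torusPoint t t#0) (torusPoint∈ t t#0)

    VanishesAlong⇒vanishing : ∀ {d} f → Homogeneous d f → VanishesAlong φ f →
                              ∀ P → P ∈ torusImage φ → eval f (coords P) ≈ 0#
    VanishesAlong⇒vanishing {d} f hf f≈0 P (t , t#0 , a , a#0 , P≈) = begin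
      eval f (coords P)            ≈⟨ eval-congʳ f P≈ ⟩
      eval f (λ i → a * φ t i)     ≈⟨ eval-homogeneous f hf a (φ t) ⟩
      a ^ d * eval f (φ t)         ≈⟨ *-congˡ (f≈0 t t#0) ⟩
      a ^ d * 0#                   ≈⟨ zeroʳ _ ⟩
      0#                           ∎
      where open ≈-Reasoning setoid

    -- A homogeneous vanishing polynomial is itself a generator, so no decomposition into generators
    -- has to be found.
    vanishingIdeal⇐ : ∀ {d} f → Homogeneous d f → VanishesAlong φ f →
                      f ∈ Generated (VanishingOn (torusImage φ))
    vanishingIdeal⇐ {d} f hf f≈0 = gen ((d , hf) , VanishesAlong⇒vanishing f hf f≈0)

    -- Equality of classes in a quotient is membership of the difference. This lemma and its
    -- converse trade it for equality of values along `φ`.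
    vanishing-difference⇒ : ∀ {f g} → (f List.++ negᴾ g) ∈ Generated (VanishingOn (torusImage φ)) →
                            ∀ t → (∀ i → t i # 0#) → eval f (φ t) ≈ eval g (φ t)
    vanishing-difference⇒ {f} {g} f-g∈ t t#0 = x∙y⁻¹≈ε⇒x≈y _ _
      (trans (sym (trans (eval-++ f (negᴾ g) (φ t)) (+-congˡ (eval-neg g (φ t)))))
             (vanishingIdeal⇒ f-g∈ t t#0))

    vanishing-difference⇐ : ∀ {d} f g → Homogeneous d f → Homogeneous d g →
                            (∀ t → (∀ i → t i # 0#) → eval f (φ t) ≈ eval g (φ t)) →
                            Submodule.Member (vanishingIdealPart (torusImage φ) d) (f List.++ negᴾ g)
    vanishing-difference⇐ {d} f g hf hg f≈g = vanishingIdeal⇐ _ hf-g (λ t t#0 →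
        trans (eval-++ f (negᴾ g) _) (trans (+-congˡ (eval-neg g _)) (x≈y⇒x∙y⁻¹≈ε (f≈g t t#0)))) , hf-g
      where
      hf-g : Homogeneous d (f List.++ negᴾ g)
      hf-g = Submodule.+-closed (homogeneous r d) {f} {negᴾ g} hf (-‿closed (homogeneous r d) {g} hg)

-- Finiteness of graded pieces and of their subquotients.

module GradedPieces {c ℓ₁ ℓ₂} (K : HeytingField c ℓ₁ ℓ₂) {q : ℕ} (order : HasOrder K q) where
  open HeytingField K hiding (zero)
  open HCRProperties heytingCommutativeRing using (#-congʳ)
  open OverField K
  open LinearMaps ring
  open FiniteField K order
  open Polynomials K

  module _ (r d : ℕ) where
    private
      H : LeftModule ring _ _
      H = submodule (homogeneous r d)
      module H = LeftModule H

      -- Runs through all vectors with entries in 0,...,d, a finite box containing every exponent of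
      -- degree d.
      exponent : Fin (ℕ.suc d ℕ.^ r) → Exponent r
      exponent i = Vec.tabulate (toℕ ∘ finToFun {ℕ.suc d} {r} i)

      exponent-surjective : ∀ e → Vec.sum e ≡ d → ∃[ i ] exponent i ≡ e
      exponent-surjective e ≡.refl = funToFin digits , ≡.trans
        (Vec.tabulate-cong (λ j → ≡.trans (≡.cong toℕ (Fin.finToFun-funToFin digits j))
                                          (Fin.toℕ-fromℕ< (ℕ.s≤s (lookup≤sum e j)))))
        (Vec.tabulate∘lookup e)
        where
        digits : Fin r → Fin (ℕ.suc (Vec.sum e))
        digits j = fromℕ< (ℕ.s≤s (lookup≤sum e j))

      X^ : ∀ e → Vec.sum e ≡ d → H.Carrierᴹ
      X^ e e≡d = (1# , e) ∷ [] , λ e′ e′≢d → hom e′ e′≢d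
        where
        hom : Homogeneous d ((1# , e) ∷ [])
        hom e′ e′≢d with e′ ≟ᵉ e
        ... | yes ≡.refl = contradiction e≡d e′≢d
        ... | no  _      = refl

      -- The box also contains vectors of other degrees. They are sent to zero, which does no harm
      -- to a spanning family.
      X^or0 : Exponent r → H.Carrierᴹ
      X^or0 e with Vec.sum e ℕ.≟ d
      ... | yes e≡d = X^ e e≡d
      ... | no  _   = H.0ᴹ

      X^or0≡X^ : ∀ e e≡d → proj₁ (X^or0 e) ≡ proj₁ (X^ e e≡d)
      X^or0≡X^ e e≡d with Vec.sum e ℕ.≟ d
      ... | yes _  = ≡.refl
      ... | no e≢d = contradiction e≡d e≢d

      monomials : Vector H.Carrierᴹ (ℕ.suc d ℕ.^ r)
      monomials = X^or0 ∘ exponent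

      X^∈span : ∀ e e≡d → InSpan H monomials (X^ e e≡d)
      X^∈span e e≡d with exponent-surjective e e≡d
      ... | i , ≡.refl = InSpan-resp H monomials {monomials i} {X^ e e≡d}
        (λ e′ → reflexive (≡.cong (λ p → coeff p e′) (X^or0≡X^ e e≡d))) (InSpan-lookup H monomials i)

      -- The part of f of degree d; f itself need not have terms of degree d only.
      part∈span : ∀ f → ∃[ g ] InSpan H monomials g ×
                               (∀ e → Vec.sum e ≡ d → coeff (proj₁ g) e ≈ coeff f e)
      part∈span [] = H.0ᴹ , InSpan-0 H monomials , λ _ _ → refl
      part∈span ((a , e) ∷ f) with part∈span f | Vec.sum e ℕ.≟ d
      ... | g , g∈span , g≈f | yes e≡d =
        (a H.*ₗ X^ e e≡d) H.+ᴹ g ,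
        InSpan-+ H monomials {a H.*ₗ X^ e e≡d} {g} (InSpan-*ₗ H monomials a {X^ e e≡d} (X^∈span e e≡d)) g∈span ,
        coeffs
        where
        coeffs : ∀ e′ → Vec.sum e′ ≡ d → coeff ((a * 1# , e) ∷ proj₁ g) e′ ≈ coeff ((a , e) ∷ f) e′
        coeffs e′ e′≡d with e′ ≟ᵉ e
        ... | yes _ = +-cong (*-identityʳ a) (g≈f e′ e′≡d)
        ... | no  _ = g≈f e′ e′≡d
      ... | g , g∈span , g≈f | no e≢d = g , g∈span , coeffs
        where
        coeffs : ∀ e′ → Vec.sum e′ ≡ d → coeff (proj₁ g) e′ ≈ coeff ((a , e) ∷ f) e′
        coeffs e′ e′≡d with e′ ≟ᵉ e
        ... | yes ≡.refl = contradiction e′≡d e≢d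
        ... | no  _      = g≈f e′ e′≡d

      monomials-spanning : Spanning H monomials
      monomials-spanning (f , hf) with part∈span f
      ... | g , g∈span , g≈f = InSpan-resp H monomials {g} {f , hf} (λ e → coeffs e (Vec.sum e ℕ.≟ d)) g∈span
        where
        coeffs : ∀ e → Dec (Vec.sum e ≡ d) → coeff (proj₁ g) e ≈ coeff f e
        coeffs e (yes e≡d) = g≈f e e≡d
        coeffs e (no  e≢d) = trans (proj₂ g e e≢d) (sym (hf e e≢d))

    -- Every coefficient vector over the spanning family is tried, so elements may repeat; only
    -- coverage matters.
    homogeneous-elements : Fin (q ℕ.^ (ℕ.suc d ℕ.^ r)) → H.Carrierᴹ
    homogeneous-elements i = combination H (vector _ i) monomials

    homogeneous-covered : ∀ y → ∃[ i ] homogeneous-elements i H.≈ᴹ y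
    homogeneous-covered y with monomials-spanning y
    ... | a , a≈y with vector-surjective a
    ...   | i , i≈a = i , H.≈ᴹ-trans {homogeneous-elements i} {combination H a monomials} {y}
        (combination-cong H {v = monomials} {w = monomials} i≈a (λ j → H.≈ᴹ-refl {monomials j})) a≈y

    -- Membership need be decided only for homogeneous polynomials: the elements of `V` are found by
    -- filtering the enumerated graded piece, and `W` is tested only on differences of such
    -- elements.
    subquotient-hasDimension :
      ∀ {v w} (V : Submodule (polynomials r) v) (W : Submodule (polynomials r) w) →
      (∀ {f} → Submodule.Member V f → Homogeneous d f) →
      (∀ f → Homogeneous d f → Dec (Submodule.Member V f)) →
      (∀ f → Homogeneous d f → Dec (Submodule.Member W f)) →
      ∃[ n ] HasDimension (V / W) n
    subquotient-hasDimension V W V⊆H V? W? = covered⇒hasDimension (V / W)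
      (λ (f , f∈V) (g , g∈V) → W? (f P.+ᴹ P.-ᴹ g) (V⊆H (V.+-closed f∈V (-‿closed V g∈V))))
      element
      covers
      where
      module P = LeftModule (polynomials r)
      module V = Submodule V
      module W = Submodule W
      element : Fin (q ℕ.^ (ℕ.suc d ℕ.^ r)) → ∃ V.Member
      element i with V? (proj₁ (homogeneous-elements i)) (proj₂ (homogeneous-elements i))
      ... | yes f∈V = _ , f∈V
      -- Zero is the default that keeps every entry of the list inside `V`.
      ... | no  _   = [] , V.0-closed
      element≡ : ∀ i → V.Member (proj₁ (homogeneous-elements i)) → proj₁ (element i) ≡ proj₁ (homogeneous-elements i)
      element≡ i f∈V with V? (proj₁ (homogeneous-elements i)) (proj₂ (homogeneous-elements i))
      ... | yes _  = ≡.refl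
      ... | no f∉V = contradiction f∈V f∉V
      covers : ∀ y → ∃[ i ] LeftModule._≈ᴹ_ (V / W) (element i) y
      covers (f , f∈V) with homogeneous-covered (f , V⊆H f∈V)
      -- The listed element and `f` have equal coefficients, so their difference is the zero
      -- polynomial and lies in `W`.
      ... | i , i≈f = i , W.resp (P.≈ᴹ-sym {proj₁ (element i) P.+ᴹ P.-ᴹ f} {P.0ᴹ}
            (P.≈ᴹ-trans {proj₁ (element i) P.+ᴹ P.-ᴹ f} {f P.+ᴹ P.-ᴹ f} {P.0ᴹ}
              (P.+ᴹ-cong {proj₁ (element i)} {f} {P.-ᴹ f} {P.-ᴹ f}
                (λ e → trans (reflexive (≡.cong (λ p → coeff p e) (element≡ i i∈V))) (i≈f e))
                (P.≈ᴹ-refl {P.-ᴹ f}))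
              (P.-ᴹ‿inverseʳ f))) W.0-closed
        where
        i∈V : V.Member (proj₁ (homogeneous-elements i))
        i∈V = V.resp (P.≈ᴹ-sym {proj₁ (homogeneous-elements i)} {f} i≈f) f∈V

  module _ {n r} .{{_ : NonZero r}} (φ : Vector Carrier n → Vector Carrier r)
           (φ-cong : ∀ {t u} → (∀ i → t i ≈ u i) → ∀ i → φ t i ≈ φ u i)
           (φ#0 : ∀ t → (∀ i → t i # 0#) → ∀ i → φ t i # 0#) (d : ℕ) where

    -- Vanishing along `φ` is a condition on the finitely many `t`. Each implication is decidable
    -- because apartness from zero and equality are, and `φ-cong` makes the condition independent of
    -- the representative of `t`.
    vanishingIdealPart? : ∀ f → Homogeneous d f → Dec (Submodule.Member (vanishingIdealPart (torusImage φ) d) f)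
    vanishingIdealPart? f hf = map′ (λ f≈0 → vanishingIdeal⇐ φ φ#0 f hf f≈0 , hf)
      (λ (f∈I , _) → vanishingIdeal⇒ φ φ#0 {f} f∈I)
      (allVectors?
        (λ t≈u f≈0 u#0 → trans (sym (eval-congʳ f (φ-cong t≈u))) (f≈0 (λ i → #-congʳ (sym (t≈u i)) (u#0 i))))
        (λ t → Fin.all? (λ i → t i #0?) →-dec (eval f (φ t) ≟ 0#)))

    HilbertFunction-defined : ∃[ h ] HilbertFunction (torusImage φ) d h
    HilbertFunction-defined = subquotient-hasDimension r d (homogeneous r d) (vanishingIdealPart (torusImage φ) d)
      id (λ f hf → yes hf) vanishingIdealPart?

-- The exact sequence attached to the graph.

module Dimensions {c ℓ₁ ℓ₂} (K : HeytingField c ℓ₁ ℓ₂) {q : ℕ} (order : HasOrder K q)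
                  {k s : ℕ} .{{_ : NonZero k}} .{{_ : NonZero s}}
                  {G : SimpleGraph (k ℕ.* 2)} (matched : IsMatchedBipartite k G)
                  (O : EdgeOrdering k G s) (d : ℕ) where
  open HeytingField K hiding (zero)
  open HCRProperties heytingCommutativeRing using (1#0; x#0y#0→xy#0; x-0≈x)
  open OverField K
  open LinearMaps ring
  open Polynomials K
  open GradedPieces K order
  open ToricSets K O
  open EdgeOrdering O
  open IsMatchedBipartite matched

  -- The parameterization of 𝕐: `𝕐` is `torusImage blockwise` by definition.
  blockwise : Vector Carrier k → Vector Carrier s
  blockwise t e = t (block e)

  edgeMonomials-cong : ∀ {t u} → (∀ i → t i ≈ u i) → ∀ e → edgeMonomials t e ≈ edgeMonomials u e
  edgeMonomials-cong t≈u e = *-cong (t≈u _) (t≈u _)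

  edgeMonomials#0 : ∀ t → (∀ i → t i # 0#) → ∀ e → edgeMonomials t e # 0#
  edgeMonomials#0 t t#0 e = x#0y#0→xy#0 (t#0 _) (t#0 _)

  blockwise#0 : ∀ t → (∀ i → t i # 0#) → ∀ e → blockwise t e # 0#
  blockwise#0 t t#0 e = t#0 (block e)

  -- 𝕐 ⊆ 𝕏: set the variables of the even vertices to 1.
  module _ (t : Vector Carrier k) where
    private
      pick : Fin k × Fin 2 → Carrier
      pick (i , zero)  = t i
      pick (i , suc _) = 1#

    oddVertices : Vector Carrier (k ℕ.* 2)
    oddVertices = pick ∘ remQuot 2

    oddVertices#0 : (∀ i → t i # 0#) → ∀ v → oddVertices v # 0#
    oddVertices#0 t#0 v = pick#0 (remQuot 2 v)
      where
      pick#0 : ∀ ij → pick ij # 0#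
      pick#0 (i , zero)  = t#0 i
      pick#0 (i , suc _) = 1#0

    blockwise≈edgeMonomials : ∀ e → blockwise t e ≈ edgeMonomials oddVertices e
    blockwise≈edgeMonomials e = sym (trans
      (*-cong (reflexive (≡.cong pick (Fin.remQuot-combine {k} {2} (block e) zero)))
              (reflexive (≡.cong pick (Fin.remQuot-combine {k} {2} (partner e) (suc zero)))))
      (*-identityʳ _))

    eval-blockwise : ∀ f → eval f (blockwise t) ≈ eval f (edgeMonomials oddVertices)
    eval-blockwise f = eval-congʳ f blockwise≈edgeMonomials

  -- A section of `block`. The matching supplies an edge at every odd vertex, so no block is empty
  -- and no variable of the target is missed.
  matchedEdge : Fin k → Fin s
  matchedEdge i = proj₁ (surjective (matching i))

  block-matchedEdge : ∀ i → block (matchedEdge i) ≡ i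
  block-matchedEdge i = proj₁ (proj₂ (surjective (matching i)))

  S/I𝕏 : LeftModule ring _ _
  S/I𝕏 = homogeneous s d / vanishingIdealPart 𝕏 d

  I𝕐/I𝕏 : LeftModule ring _ _
  I𝕐/I𝕏 = vanishingIdealPart 𝕐 d / vanishingIdealPart 𝕏 d

  S/I𝕋 : LeftModule ring _ _
  S/I𝕋 = homogeneous k d / vanishingIdealPart (𝕋 k) d

  private
    module S/I𝕏 = LeftModule S/I𝕏
    module I𝕐/I𝕏 = LeftModule I𝕐/I𝕏
    module S/I𝕋 = LeftModule S/I𝕋

    ≈𝕋 : ∀ x y → (∀ t → (∀ i → t i # 0#) → eval (proj₁ x) t ≈ eval (proj₁ y) t) → x S/I𝕋.≈ᴹ y
    ≈𝕋 (f , hf) (g , hg) = vanishing-difference⇐ id (λ _ → id) f g hf hg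

    ≈𝕋⇒ : ∀ x y → x S/I𝕋.≈ᴹ y → ∀ t → (∀ i → t i # 0#) → eval (proj₁ x) t ≈ eval (proj₁ y) t
    ≈𝕋⇒ (f , hf) (g , hg) (f-g∈I , _) = vanishing-difference⇒ id (λ _ → id) {f} {g} f-g∈I

    ≈𝕏⇒ : ∀ x y → x S/I𝕏.≈ᴹ y → ∀ t → (∀ i → t i # 0#) →
          eval (proj₁ x) (edgeMonomials t) ≈ eval (proj₁ y) (edgeMonomials t)
    ≈𝕏⇒ (f , hf) (g , hg) (f-g∈I , _) = vanishing-difference⇒ edgeMonomials edgeMonomials#0 {f} {g} f-g∈I

  inclusion : I𝕐/I𝕏.Carrierᴹ → S/I𝕏.Carrierᴹ
  inclusion (f , _ , hf) = f , hf

  inclusion-linear : IsLinear I𝕐/I𝕏 S/I𝕏 inclusion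
  inclusion-linear = record
    -- Both quotients are modulo I_𝕏(d), so equality of classes is the same membership on either
    -- side; for the same reason injectivity is an identity function.
    { cong    = id
    ; +-homo  = λ x y → S/I𝕏.≈ᴹ-refl {inclusion (x I𝕐/I𝕏.+ᴹ y)}
    ; *ₗ-homo = λ a x → S/I𝕏.≈ᴹ-refl {inclusion (a I𝕐/I𝕏.*ₗ x)}
    }

  -- X_e ↦ X_i for the edges e in the block of odd i.
  collapse : S/I𝕏.Carrierᴹ → S/I𝕋.Carrierᴹ
  collapse (f , hf) = mapExponents (push block) f , homogeneous-mapExponents (push block) (sum-push block) f hf

  eval-collapse : ∀ x t → eval (proj₁ (collapse x)) t ≈ eval (proj₁ x) (blockwise t)
  eval-collapse (f , _) t = eval-mapExponents-push block f t

  collapse-linear : IsLinear S/I𝕏 S/I𝕋 collapse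
  collapse-linear = record
    -- The hypothesis controls values at `edgeMonomials` only; `oddVertices t` rewrites
    -- `blockwise t` in that form.
    { cong    = λ {x} {y} x≈y → ≈𝕋 (collapse x) (collapse y) λ t t#0 → begin
        eval (proj₁ (collapse x)) t                        ≈⟨ eval-collapse x t ⟩
        eval (proj₁ x) (blockwise t)                       ≈⟨ eval-blockwise t (proj₁ x) ⟩
        eval (proj₁ x) (edgeMonomials (oddVertices t))     ≈⟨ ≈𝕏⇒ x y x≈y (oddVertices t) (oddVertices#0 t t#0) ⟩
        eval (proj₁ y) (edgeMonomials (oddVertices t))     ≈⟨ eval-blockwise t (proj₁ y) ⟨
        eval (proj₁ y) (blockwise t)                       ≈⟨ eval-collapse y t ⟨
        eval (proj₁ (collapse y)) t                        ∎
    ; +-homo  = λ x y → ≈𝕋 (collapse (x S/I𝕏.+ᴹ y)) (collapse x S/I𝕋.+ᴹ collapse y) λ t _ → begin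
        eval (proj₁ (collapse (x S/I𝕏.+ᴹ y))) t                         ≈⟨ eval-collapse (x S/I𝕏.+ᴹ y) t ⟩
        eval (proj₁ x List.++ proj₁ y) (blockwise t)                    ≈⟨ eval-++ (proj₁ x) (proj₁ y) (blockwise t) ⟩
        eval (proj₁ x) (blockwise t) + eval (proj₁ y) (blockwise t)     ≈⟨ +-cong (eval-collapse x t) (eval-collapse y t) ⟨
        eval (proj₁ (collapse x)) t + eval (proj₁ (collapse y)) t       ≈⟨ eval-++ (proj₁ (collapse x)) (proj₁ (collapse y)) t ⟨
        eval (proj₁ (collapse x) List.++ proj₁ (collapse y)) t          ∎
    ; *ₗ-homo = λ a x → ≈𝕋 (collapse (a S/I𝕏.*ₗ x)) (a S/I𝕋.*ₗ collapse x) λ t _ → begin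
        eval (proj₁ (collapse (a S/I𝕏.*ₗ x))) t        ≈⟨ eval-collapse (a S/I𝕏.*ₗ x) t ⟩
        eval (scaleᴾ a (proj₁ x)) (blockwise t)        ≈⟨ eval-scale a (proj₁ x) (blockwise t) ⟩
        a * eval (proj₁ x) (blockwise t)               ≈⟨ *-congˡ (eval-collapse x t) ⟨
        a * eval (proj₁ (collapse x)) t                ≈⟨ eval-scale a (proj₁ (collapse x)) t ⟨
        eval (scaleᴾ a (proj₁ (collapse x))) t         ∎
    }
    where open ≈-Reasoning setoid

  collapse∘inclusion≈0 : ∀ x → collapse (inclusion x) S/I𝕋.≈ᴹ S/I𝕋.0ᴹ
  collapse∘inclusion≈0 x@(f , f∈I , hf) = ≈𝕋 (collapse (inclusion x)) S/I𝕋.0ᴹ λ t t#0 →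
    trans (eval-collapse (inclusion x) t) (vanishingIdeal⇒ blockwise blockwise#0 {f} f∈I t t#0)

  -- The value of `collapse y` at `t` is the value of `y` at `blockwise t`, so the same polynomial,
  -- now known to vanish on 𝕐, is the preimage.
  kernel-collapse⊆inclusion : ∀ y → collapse y S/I𝕋.≈ᴹ S/I𝕋.0ᴹ → ∃[ x ] inclusion x S/I𝕏.≈ᴹ y
  kernel-collapse⊆inclusion y@(f , hf) y≈0 =
    (f , vanishingIdeal⇐ blockwise blockwise#0 f hf f≈0 , hf) , S/I𝕏.≈ᴹ-refl {y}
    where
    f≈0 : VanishesAlong blockwise f
    f≈0 t t#0 = trans (sym (eval-collapse y t)) (≈𝕋⇒ (collapse y) S/I𝕋.0ᴹ y≈0 t t#0)

  -- The section property of `matchedEdge` is used through values only: equality modulo I_𝕋 does not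
  -- ask for the two substitutions to compose to the identity on polynomials.
  collapse-surjective : ∀ z → ∃[ y ] collapse y S/I𝕋.≈ᴹ z
  collapse-surjective z@(g , hg) = y , ≈𝕋 (collapse y) z λ t _ → begin
    eval (proj₁ (collapse y)) t              ≈⟨ eval-collapse y t ⟩
    eval (proj₁ y) (blockwise t)             ≈⟨ eval-mapExponents-push matchedEdge g (blockwise t) ⟩
    eval g (blockwise t ∘ matchedEdge)       ≈⟨ eval-congʳ g (λ i → reflexive (≡.cong t (block-matchedEdge i))) ⟩
    eval g t                                 ∎
    where
    open ≈-Reasoning setoid
    y : S/I𝕏.Carrierᴹ
    y = mapExponents (push matchedEdge) g ,
        homogeneous-mapExponents (push matchedEdge) (sum-push matchedEdge) g hg

  Hψ-defined : ∃[ h ] Hψ d h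
  Hψ-defined = subquotient-hasDimension s d (vanishingIdealPart 𝕐 d) (vanishingIdealPart 𝕏 d)
    proj₂ (vanishingIdealPart? blockwise (λ t≈u e → t≈u (block e)) blockwise#0 d)
    (vanishingIdealPart? edgeMonomials edgeMonomials-cong edgeMonomials#0 d)

  H𝕋-defined : ∃[ h ] HilbertFunction (𝕋 k) d h
  H𝕋-defined = HilbertFunction-defined id id (λ _ → id) d

  H𝕏≡Hψ+H𝕋 : ∀ {h h′} → Hψ d h → HilbertFunction (𝕋 k) d h′ → HilbertFunction 𝕏 d (h ℕ.+ h′)
  H𝕏≡Hψ+H𝕋 = extension-hasDimension inclusion-linear collapse-linear (λ _ → id)
    collapse∘inclusion≈0 kernel-collapse⊆inclusion collapse-surjective

  divide≈0⇒≈0 : ∀ x {z} (z#0 : z # 0#) → divide x z#0 ≈ 0# → x ≈ 0#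
  divide≈0⇒≈0 x {z} z#0 x/z≈0 = begin
    x                          ≈⟨ *-identityʳ x ⟨
    x * 1#                     ≈⟨ *-congˡ (proj₁ (proj₂ (#⇒invertible z#0))) ⟨
    x * (z⁻¹ * (z - 0#))       ≈⟨ *-assoc x z⁻¹ _ ⟨
    divide x z#0 * (z - 0#)    ≈⟨ *-congʳ x/z≈0 ⟩
    0# * (z - 0#)              ≈⟨ zeroˡ _ ⟩
    0#                         ∎
    where
    open ≈-Reasoning setoid
    z⁻¹ = proj₁ (#⇒invertible z#0)

  -- The evaluation code as a copy of S_d/I_𝕏(d).

  module _ {m} (E : Enumeration 𝕏 m) where
    open Enumeration E

    private
      X₁^d#0 : ∀ i → _ # 0#
      X₁^d#0 i = ^#0 (𝕏-coords#0 (first s) (point i) (sound i)) d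

    codeword : S/I𝕏.Carrierᴹ → LeftModule.Carrierᴹ (C𝕏 E d)
    codeword (f , hf) = (λ i → divide (eval f (coords (point i))) (X₁^d#0 i)) , f , hf , λ i → refl

    codeword-linear : IsLinear S/I𝕏 (C𝕏 E d) codeword
    codeword-linear = record
      { cong    = λ { {f , hf} {g , hg} x≈y i → *-congʳ (
          -- The point is `a` times a vector of edge monomials; homogeneity pulls the d-th power of
          -- `a` out on both sides, leaving the known equality at `edgeMonomials t`.
          let t , t#0 , a , a#0 , P≈ = sound i in begin
          eval f (coords (point i))               ≈⟨ eval-congʳ f P≈ ⟩
          eval f (λ j → a * edgeMonomials t j)    ≈⟨ eval-homogeneous f hf a _ ⟩
          _ * eval f (edgeMonomials t)            ≈⟨ *-congˡ (≈𝕏⇒ (f , hf) (g , hg) x≈y t t#0) ⟩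
          _ * eval g (edgeMonomials t)            ≈⟨ eval-homogeneous g hg a _ ⟨
          eval g (λ j → a * edgeMonomials t j)    ≈⟨ eval-congʳ g P≈ ⟨
          eval g (coords (point i))               ∎) }
      ; +-homo  = λ (f , _) (g , _) i → trans (*-congʳ (eval-++ f g _)) (distribʳ _ _ _)
      ; *ₗ-homo = λ a (f , _) i → trans (*-congʳ (eval-scale a f _)) (*-assoc a _ _)
      }
      where open ≈-Reasoning setoid

    -- Completeness of the enumeration makes each `edgeMonomials t` proportional to a listed point,
    -- where a zero entry of the codeword forces `f` to vanish; homogeneity carries this over to
    -- `edgeMonomials t`.
    codeword-injective : ∀ x → LeftModule._≈ᴹ_ (C𝕏 E d) (codeword x) (LeftModule.0ᴹ (C𝕏 E d)) →
                         x S/I𝕏.≈ᴹ S/I𝕏.0ᴹ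
    codeword-injective (f , hf) w≈0 =
      vanishing-difference⇐ edgeMonomials edgeMonomials#0 f [] hf (λ _ _ → refl) f≈0
      where
      open ≈-Reasoning setoid
      f≈0 : VanishesAlong edgeMonomials f
      f≈0 t t#0 with complete (torusPoint edgeMonomials edgeMonomials#0 t t#0)
                              (torusPoint∈ edgeMonomials edgeMonomials#0 t t#0)
      ... | i , a , a#0 , P≈ = begin
        eval f (edgeMonomials t)                    ≈⟨ eval-congʳ f P≈ ⟩
        eval f (λ j → a * coords (point i) j)       ≈⟨ eval-homogeneous f hf a _ ⟩
        _ * eval f (coords (point i))               ≈⟨ *-congˡ (divide≈0⇒≈0 _ (X₁^d#0 i) (w≈0 i)) ⟩
        _ * 0#                                      ≈⟨ zeroʳ _ ⟩
        0#                                          ∎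

    codeword-surjective : ∀ w → ∃[ x ] LeftModule._≈ᴹ_ (C𝕏 E d) (codeword x) w
    codeword-surjective (w , f , hf , w≈) = (f , hf) , λ i → sym (w≈ i)

    dimension-C𝕏 : ∀ {h} → HilbertFunction 𝕏 d h → HasDimension (C𝕏 E d) h
    dimension-C𝕏 = isomorphism-hasDimension codeword-linear codeword-injective codeword-surjective

open import Data.Nat using (_+_; _*_)

theorem5p2 : ∀ {c ℓ₁ ℓ₂} (K : HeytingField c ℓ₁ ℓ₂) (q : ℕ) → HasOrder K q →
    (k s : ℕ) .{{_ : NonZero k}} .{{_ : NonZero s}} →
    (G : SimpleGraph (k * 2)) → IsMatchedBipartite k G → (O : EdgeOrdering k G s) →
    let open OverField K
        open ToricSets K O
    in
    (d : ℕ) →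
    ∃[ hX ] ∃[ hψ ] ∃[ hT ]
      (∀ {m} (E : Enumeration 𝕏 m) → HasDimension (C𝕏 E d) hX) ×
      HilbertFunction 𝕏 d hX ×
      Hψ d hψ ×
      HilbertFunction (𝕋 k) d hT ×
      hX ≡ hψ + hT
theorem5p2 K q order k s G matched O d =
  let hψ , ψ = Hψ-defined
      hT , T = H𝕋-defined
      X = H𝕏≡Hψ+H𝕋 ψ T
  -- The first witness is the sum itself, so the final equation is reflexivity. It is fixed before
  -- any `E`, so one number serves all enumerations of 𝕏.
  in hψ + hT , hψ , hT , (λ E → dimension-C𝕏 E X) , X , ψ , T , ≡.refl
  where open Dimensions K order matched O d
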